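{- For every integer $n\ge 2$, the number $t(n)$ of toppleable permutations in $S_n$ equals the number of acyclic orientations of the complete bipartite graph $K_{\lceil n/2\rceil,\lfloor n/2\rfloor+1}$ having a unique sink, which is a fixed prescribed vertex.
   Context: Toppling model. For an integer $n\ge 2$ let $L_n=\{ -\lfloor (n+1)/2\rfloor,\dots,-1,0,1,\dots,\lfloor n/2\rfloor+1\}\subset\mathbb{Z}$; position $0$ is the origin. A configuration places chips carrying distinct integer labels at positions of $L_n$. A toppling move chooses a position $i$ holding at least two chips, chooses two chips $\alpha<\beta$ at $i$, and moves $\alpha$ to $i-1$ and $\beta$ to $i+1$. The process applies toppling moves (arbitrary choices) until no position holds two or more chips. For $\pi\in S_n$ and $r\in[n+1]$, the initial configuration $\pi^{(r)}$ has, for each $j=1,\dots,n$, one chip at position $-\lfloor (n-1)/2\rfloor+j-1$ labeled $\pi_j$ if $\pi_j<r$ and $\pi_j+1$ if $\pi_j\ge r$, plus a chip labeled $r$ at the origin. The final configuration does not depend on the choices and has at most one chip per position; reading chips left to right gives $\mathcal{T}(\pi,r)\in S_{n+1}$. $\pi$ is $r$-toppleable if $\mathcal{T}(\pi,r)$ is the identity, and toppleable if it is $r$-toppleable for all $r\in[n+1]$; $t(n)$ is the number of toppleable permutations in $S_n$. An acyclic orientation of a simple graph is an assignment of directions to its edges with no directed cycle; a sink is a vertex with no outgoing edge. -}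

module Defs where

open import Data.Nat as ℕ using (ℕ; zero; suc; _∸_; ⌊_/2⌋; ⌈_/2⌉)
open import Data.Integer as ℤ using (ℤ; +_)
open import Data.Fin using (Fin)
open import Data.Bool using (Bool; true; false)
open import Data.Vec using (Vec; lookup)
open import Data.List using (List; []; _∷_; map; length; upTo)
open import Data.List.Membership.Propositional using (_∈_)
open import Data.List.Relation.Unary.Unique.Propositional using (Unique)
open import Data.List.Relation.Unary.Linked using (Linked)
open import Data.List.Relation.Binary.Permutation.Propositional using (_↭_)
open import Data.Product using (Σ; _×_; _,_; proj₁; proj₂; ∃)
open import Data.Sum using (_⊎_; inj₁; inj₂)
open import Relation.Nullary using (¬_)
open import Relation.Binary.PropositionalEquality using (_≡_)
open import Relation.Binary.Construct.Closure.ReflexiveTransitive using (Star)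
open import Relation.Binary.Construct.Closure.Transitive using (TransClosure)

CountIs : {A : Set} → (A → Set) → ℕ → Set
CountIs {A} P k =
  Σ (List A) λ l → (length l ≡ k) × Unique l × (∀ x → (x ∈ l → P x) × (P x → x ∈ l))

oneTo : ℕ → List ℕ
oneTo n = map suc (upTo n)

IsPerm : ℕ → List ℕ → Set
IsPerm n π = π ↭ oneTo n

-- Toppling model.  A chip is a pair (position , label); a configuration
-- is a list of chips (order in the list is irrelevant, see Move).

Chip : Set
Chip = ℤ × ℕ

Config : Set
Config = List Chip

data Move : Config → Config → Set where
  topple : (c rest : Config) (i : ℤ) (α β : ℕ) → α ℕ.< β →
           c ↭ ((i , α) ∷ (i , β) ∷ rest) →
           Move c ((i ℤ.- + 1 , α) ∷ (i ℤ.+ + 1 , β) ∷ rest)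

Stable : Config → Set
Stable c = Unique (map proj₁ c)

ReadsAs : Config → List ℕ → Set
ReadsAs c w = Σ Config λ s → (s ↭ c) × Linked (λ x y → proj₁ x ℤ.< proj₁ y) s × (map proj₂ s ≡ w)

relabel : ℕ → ℕ → ℕ
relabel r x with x ℕ.<ᵇ r
... | true  = x
... | false = suc x

place : ℕ → ℤ → List ℕ → Config
place r p []       = []
place r p (x ∷ xs) = (p , relabel r x) ∷ place r (p ℤ.+ + 1) xs

initial : ℕ → List ℕ → ℕ → Config
initial n π r = (+ 0 , r) ∷ place r (ℤ.- (+ ⌊ (n ∸ 1) /2⌋)) π

-- π is r-toppleable: the toppling process started at π^(r) ends in a
-- stable configuration reading as the identity [1,…,n+1] of S_{n+1}.
-- (The final configuration is independent of choices.)
RToppleable : ℕ → List ℕ → ℕ → Set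
RToppleable n π r =
  ∃ λ c → Star Move (initial n π r) c × Stable c × ReadsAs c (oneTo (suc n))

Toppleable : ℕ → List ℕ → Set
Toppleable n π = IsPerm n π × (∀ r → 1 ℕ.≤ r → r ℕ.≤ suc n → RToppleable n π r)

Orientation : ℕ → ℕ → Set
Orientation a b = Vec (Vec Bool b) a

Vertex : ℕ → ℕ → Set
Vertex a b = Fin a ⊎ Fin b

data Arc {a b : ℕ} (o : Orientation a b) : Vertex a b → Vertex a b → Set where
  lr : (i : Fin a) (j : Fin b) → lookup (lookup o i) j ≡ true  → Arc o (inj₁ i) (inj₂ j)
  rl : (i : Fin a) (j : Fin b) → lookup (lookup o i) j ≡ false → Arc o (inj₂ j) (inj₁ i)

Acyclic : {a b : ℕ} → Orientation a b → Set
Acyclic o = ∀ x → ¬ TransClosure (Arc o) x x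

IsSink : {a b : ℕ} → Orientation a b → Vertex a b → Set
IsSink o x = ∀ y → ¬ Arc o x y

AcyclicUniqueSinkAt : {a b : ℕ} → Vertex a b → Orientation a b → Set
AcyclicUniqueSinkAt v o = Acyclic o × IsSink o v × (∀ x → IsSink o x → x ≡ v)

{-# OPTIONS --safe #-}
-- Toppling π^(r) runs a rectangular network of comparators.  With a = ⌊(n-1)/2⌋ and b = ⌊n/2⌋, the
-- chip of π at position -x (0 ≤ x ≤ a) starts on row x, the one at position y (1 ≤ y ≤ b) on column y
-- and the chip r on column 0; where row x meets column y, the larger chip continues along the row and
-- the smaller one along the column.  Bounding how far a chip can get in this network shows that π is
-- toppleable if and only if -a ≤ π_i - i ≤ b for all i.
--
-- An orientation of K_{a+1,b+1} is acyclic iff the out-neighbourhoods of its left vertices form a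
-- chain; a unique sink on the left is one empty neighbourhood, the other a being nonempty.
--
-- Both numbers obey the same recursions.  For permutations, m counts the rows among the first a whose
-- entry is at most b + 1, hence also the free columns beyond b + 1 so far open; for tuples of subsets,
-- m counts the distinct ones.  A further row takes one of the m free columns, or repeats one of the m
-- subsets, or else raises m by one.  What remains is counted by m! times the number of maps from a
-- (b+1)-set to {0,…,m} that hit 1,…,m.  A unique sink on the right exchanges a and b, under which the
-- count Σ (m+1)! m! S(a+1,m+1) S(b+1,m+1) is symmetric.
module Submission where

open import Defs
open import Data.Nat using (ℕ; suc; _≤_; ⌊_/2⌋; ⌈_/2⌉)
open import Data.Product using (Σ; _×_)

open import Data.Bool using (Bool; true; false; if_then_else_; not; _∧_; T)
import Data.Bool.Properties as Boolₚ using (_≟_; not-injective; not-involutive; ¬-not; ∧-identityʳ)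
open import Data.Fin as Fin using (Fin; zero; suc)
import Data.Fin.Properties as Finₚ using (_≟_; punchIn-punchOut; punchInᵢ≢i)
open import Data.Integer as ℤ using (ℤ; _⊖_)
import Data.Integer.Properties as ℤₚ
  using (+-cancelˡ-⊖; <-asym; <-irrefl; <-trans; <⇒≢; distribˡ-⊖-+-neg; distribˡ-⊖-+-pos; ⊖-monoˡ-<; ⊖-≤)
open import Data.List using (List; []; _∷_; map; length; upTo; downFrom; applyUpTo; concatMap; replicate; zipWith; head; _++_)
open import Data.List.Membership.Propositional using (_∈_; lose; find)
open import Data.List.Membership.Propositional.Properties
  using (∈-map⁺; ∈-map⁻; ∈-++⁺ˡ; ∈-++⁺ʳ; ∈-++⁻; ∈-concatMap⁺; ∈-concatMap⁻; ∈-∃++; ∈-upTo⁺; ∈-upTo⁻)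
open import Data.List.Membership.Propositional.Properties.WithK using (unique∧set⇒bag)
import Data.List.Membership.DecPropositional as DecMembership using (_∈?_)
open import Data.List.Properties
  using (∷-injective; ∷-injectiveʳ; length-++; length-map; length-replicate; length-upTo; map-++; map-cong; map-cong-local;
         map-id; map-upTo; map-∘; reverse-upTo; ++-identityʳ)
open import Data.List.Relation.Binary.BagAndSetEquality using (∼bag⇒↭)
open import Data.List.Relation.Binary.Permutation.Propositional as ↭
  using (_↭_; prep; swap; ↭-refl; ↭-sym; ↭-trans; ↭-reflexive; ↭⇒↭ₛ)
open import Data.List.Relation.Binary.Permutation.Propositional.Properties
  using (map⁺; shift; drop-∷; ++-comm; ++⁺ˡ; ∈-resp-↭; All-resp-↭; ↭-empty-inv; ↭-length; ↭-map-inv; ↭-reverse; ¬x∷xs↭[])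
import Data.List.Relation.Binary.Permutation.Setoid.Properties as PermSetoid using (Unique-resp-↭)
open import Data.List.Relation.Binary.Pointwise as Pointwise using (Pointwise; []; _∷_)
open import Data.List.Relation.Unary.All as All using (All; []; _∷_)
open import Data.List.Relation.Unary.AllPairs as AllPairs using (AllPairs; []; _∷_)
import Data.List.Relation.Unary.AllPairs.Properties as AllPairsₚ using (applyUpTo⁺₁; map⁺; map⁻)
open import Data.List.Relation.Unary.Any using (here; there)
open import Data.List.Relation.Unary.Linked using (Linked)
import Data.List.Relation.Unary.Linked.Properties as Linkedₚ using (Linked⇒AllPairs; applyUpTo⁺₂; map⁺)
open import Data.List.Relation.Unary.Unique.Propositional using (Unique)
import Data.List.Relation.Unary.Unique.Propositional.Properties as Uniqueₚ using (++⁺; map⁺; map⁻; upTo⁺)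
open import Data.Maybe using (Maybe; just)
open import Data.Maybe.Properties using (just-injective)
open import Data.Nat as ℕ using (zero; pred; _+_; _*_; _∸_; _<_; _≤ᵇ_; z≤n; s≤s; _!)
open import Data.Nat.Induction using (<-wellFounded)
open import Data.Nat.ListAction using (sum)
open import Data.Nat.Properties
  using (*-assoc; *-comm; *-identityʳ; *-zeroʳ; +-assoc; +-cancelʳ-≡; +-cancelʳ-≤; +-cancelˡ-≡; +-cancelˡ-≤;
         +-comm; +-identityʳ; +-mono-<; +-mono-<-≤; +-mono-≤; +-mono-≤-<; +-monoʳ-<; +-monoʳ-≤; +-monoˡ-<;
         +-monoˡ-≤; +-suc; +-∸-assoc; <-asym; <-cmp; <-irrefl; <-trans; <-≤-trans; <ᵇ⇒<; <⇒<ᵇ; <⇒≢; <⇒≤;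
         <⇒≤pred; <⇒≱; m+1+n≰m; m+[n∸m]≡n; m+n∸m≡n; m+n≤o⇒m≤o∸n; m<m+n; m∸[m∸n]≡n; m∸n+n≡m; m∸n≡0⇒m≤n; m∸n≤m;
         m≤m+n; m≤n+m; m≤n+o⇒m∸n≤o; m≤n⇒m<n∨m≡n; n≤1+n; suc-injective; ∸-cancelʳ-≡; ∸-cancelˡ-≡; ∸-monoˡ-≤;
         ≤-<-trans; ≤-antisym; ≤-refl; ≤-reflexive; ≤-trans; ≤ᵇ⇒≤; ≤⇒≤ᵇ; ≤∧≢⇒<; ≮⇒≥; ≰⇒>; ≰⇒≥; ⌊n/2⌋+⌈n/2⌉≡n;
         _≟_; _≤?_; module ≤-Reasoning)
open import Data.Nat.Solver using (module +-*-Solver)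
open import Data.Product using (_,_; proj₁; proj₂; ∃)
open import Data.Sum as Sum using (_⊎_; inj₁; inj₂)
open import Data.Sum.Properties using (inj₁-injective; swap-involutive)
open import Data.Vec as Vec using (Vec; []; _∷_; lookup; toList; insertAt; removeAt; tabulate)
open import Data.Vec.Membership.Propositional.Properties using (∈-lookup; ∈-toList⁺; ∈-toList⁻)
import Data.Vec.Properties as Vecₚ
  using (insertAt-lookup; insertAt-punchIn; insertAt-removeAt; lookup-replicate; lookup∘tabulate;
         removeAt-insertAt; tabulate-cong; tabulate∘lookup; ≡-dec)
import Data.Vec.Relation.Unary.Any as VecAny using (index)
import Data.Vec.Relation.Unary.Any.Properties as VecAnyₚ using (lookup-index)
open import Function.Base using (id; _∘_; _⟨_⟩_)
open import Function.Bundles using (mk⇔)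
open import Induction.WellFounded using (Acc; acc)
open import Relation.Binary.Construct.Closure.ReflexiveTransitive using (Star; ε; _◅_; _◅◅_)
open import Relation.Binary.Construct.Closure.Transitive using (TransClosure; [_]; _∷_)
open import Relation.Binary.Definitions using (Tri; tri<; tri≈; tri>)
open import Relation.Binary.PropositionalEquality
  using (_≡_; _≢_; refl; sym; trans; cong; cong₂; subst; subst₂; setoid; module ≡-Reasoning)
open import Relation.Nullary using (¬_; contradiction; Dec; yes; no; does)
open import Relation.Nullary.Decidable using (map′)

-- Confluence of toppling is never proved. Sufficiency of the band exhibits a single run, row by
-- row; necessity takes an arbitrary run and simulates each move by a comparator. For the
-- simulation, positions alone must reveal which cell fires. They do, because the toppled cells
-- always form a Young diagram: two chips coincide exactly at a cell that can be added to it, and a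
-- stable configuration has filled the whole rectangle. The band is tight because of two extreme
-- insertions: r = 1 raises every label of π by one and r = n + 1 raises none. The former forces all
-- the upper inequalities, the latter all the lower ones. Rows and columns play different parts in
-- the recursion, so its symmetry in a and b is invisible there. Rewriting the count through
-- Stirling numbers brings the symmetry out, and this is what allows the sink to lie on either side.

-- Finite lists

Unique-resp-↭ : {A : Set} {xs ys : List A} → xs ↭ ys → Unique xs → Unique ys
Unique-resp-↭ {A} p = PermSetoid.Unique-resp-↭ (setoid A) (↭⇒↭ₛ p)

unique-set⇒↭ : {A : Set} {xs ys : List A} → Unique xs → Unique ys →
  (∀ {x} → x ∈ xs → x ∈ ys) → (∀ {x} → x ∈ ys → x ∈ xs) → xs ↭ ys
unique-set⇒↭ uxs uys to from = ∼bag⇒↭ (unique∧set⇒bag uxs uys (mk⇔ to from))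

∈⇒↭∷ : {A : Set} {x : A} {xs : List A} → x ∈ xs → ∃ λ ys → xs ↭ x ∷ ys
∈⇒↭∷ x∈xs with ∈-∃++ x∈xs
... | ys , zs , refl = ys ++ zs , shift _ ys zs

unique-map-injective : {A B : Set} {f : A → B} {xs : List A} → Unique (map f xs) →
  ∀ {x y} → x ∈ xs → y ∈ xs → f x ≡ f y → x ≡ y
unique-map-injective (_ ∷ _)     (here refl) (here refl) _  = refl
unique-map-injective {f = f} (fx∉ ∷ _) (here refl) (there q) eq = contradiction eq (All.lookup fx∉ (∈-map⁺ f q))
unique-map-injective {f = f} (fx∉ ∷ _) (there p) (here refl) eq = contradiction (sym eq) (All.lookup fx∉ (∈-map⁺ f p))
unique-map-injective (_ ∷ u)     (there p)   (there q)   eq = unique-map-injective u p q eq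

∈-oneTo⁺ : ∀ {n v} → 1 ≤ v → v ≤ n → v ∈ oneTo n
∈-oneTo⁺ {v = suc v} _ v<n = ∈-map⁺ suc (∈-upTo⁺ v<n)

∈-oneTo⁻ : ∀ {n v} → v ∈ oneTo n → 1 ≤ v × v ≤ n
∈-oneTo⁻ v∈ with ∈-map⁻ suc v∈
... | _ , u∈ , refl = s≤s z≤n , ∈-upTo⁻ u∈

oneTo-unique : ∀ n → Unique (oneTo n)
oneTo-unique n = Uniqueₚ.map⁺ suc-injective (Uniqueₚ.upTo⁺ n)

range : ℕ → ℕ → List ℕ
range i zero    = []
range i (suc k) = i ∷ range (suc i) k

applyUpTo-range : ∀ (f : ℕ → ℕ) i k → (∀ j → f j ≡ j + i) → applyUpTo f k ≡ range i k
applyUpTo-range f i zero    f≗ = refl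
applyUpTo-range f i (suc k) f≗ = cong₂ _∷_ (f≗ 0)
  (applyUpTo-range (f ∘ suc) (suc i) k (λ j → trans (f≗ (suc j)) (sym (+-suc j i))))

upTo-range : ∀ k → upTo k ≡ range 0 k
upTo-range k = applyUpTo-range id 0 k (λ j → sym (+-identityʳ j))

oneTo-range : ∀ k → oneTo k ≡ range 1 k
oneTo-range k = trans (map-upTo suc k) (applyUpTo-range suc 1 k (λ j → sym (+-comm j 1)))

range-++ : ∀ i j k → range i (j + k) ≡ range i j ++ range (j + i) k
range-++ i zero    k = refl
range-++ i (suc j) k = cong (i ∷_) (trans (range-++ (suc i) j k) (cong (λ h → range (suc i) j ++ range h k) (+-suc j i)))

∈-range⁻ : ∀ i k {v} → v ∈ range i k → i ≤ v × v < i + k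
∈-range⁻ i (suc k) (here refl) = ≤-refl , m<m+n i (s≤s z≤n)
∈-range⁻ i (suc k) (there v∈) with ∈-range⁻ (suc i) k v∈
... | i<v , v< = <⇒≤ i<v , ≤-trans v< (≤-reflexive (sym (+-suc i k)))

perm-length : ∀ {n π} → IsPerm n π → length π ≡ n
perm-length {n} perm = trans (↭-length perm) (trans (length-map suc (upTo n)) (length-upTo n))

-- The two inverse laws are asymmetric on purpose: removing an inserted row always restores the
-- tuple, but reinserting `∅` restores only an orientation whose removed row was empty.
CountIs-bijection : {A B : Set} {P : A → Set} {Q : B → Set} {k : ℕ} (f : A → B) (g : B → A) →
  (∀ {x} → P x → Q (f x)) → (∀ {y} → Q y → P (g y)) →
  (∀ x → g (f x) ≡ x) → (∀ {y} → Q y → f (g y) ≡ y) →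
  CountIs P k → CountIs Q k
CountIs-bijection {P = P} {Q} f g P⇒Q Q⇒P gf fg (xs , len , uxs , xs⇔P) =
  map f xs , trans (length-map f xs) len ,
  Uniqueₚ.map⁺ (λ {x} {y} eq → trans (sym (gf x)) (trans (cong g eq) (gf y))) uxs ,
  λ y → sound y , complete y
  where
  sound : ∀ y → y ∈ map f xs → Q y
  sound y y∈ with ∈-map⁻ f y∈
  ... | x , x∈ , refl = P⇒Q (proj₁ (xs⇔P x) x∈)
  complete : ∀ y → Q y → y ∈ map f xs
  complete y qy with ∈-map⁺ f (proj₂ (xs⇔P (g y)) (Q⇒P qy))
  ... | fgy∈ rewrite fg qy = fgy∈

CountIs-⇔ : {A : Set} {P Q : A → Set} {k : ℕ} →
  (∀ {x} → P x → Q x) → (∀ {x} → Q x → P x) → CountIs P k → CountIs Q k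
CountIs-⇔ to from (xs , len , uxs , xs⇔P) =
  xs , len , uxs , λ x → (λ x∈ → to (proj₁ (xs⇔P x) x∈)) , (λ qx → proj₂ (xs⇔P x) (from qx))

length-concatMap : {A B : Set} (f : A → List B) (xs : List A) → length (concatMap f xs) ≡ sum (map (length ∘ f) xs)
length-concatMap f []       = refl
length-concatMap f (x ∷ xs) = trans (length-++ (f x)) (cong (length (f x) +_) (length-concatMap f xs))

sum-map-const : {A : Set} {f : A → ℕ} {k : ℕ} (xs : List A) → (∀ {x} → x ∈ xs → f x ≡ k) → sum (map f xs) ≡ length xs * k
sum-map-const []       f≗k = refl
sum-map-const (x ∷ xs) f≗k = cong₂ _+_ (f≗k (here refl)) (sum-map-const xs (λ p → f≗k (there p)))

concatMap-unique : {A B : Set} {f : A → List B} {xs : List A} → Unique xs → (∀ {x} → x ∈ xs → Unique (f x)) →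
  (∀ {x y z} → x ∈ xs → y ∈ xs → z ∈ f x → z ∈ f y → x ≡ y) → Unique (concatMap f xs)
concatMap-unique {xs = []} _ _ _ = []
concatMap-unique {f = f} {x ∷ xs} (x∉ ∷ uxs) uf determined = Uniqueₚ.++⁺ (uf (here refl))
  (concatMap-unique uxs (λ p → uf (there p)) (λ p q → determined (there p) (there q))) disjoint
  where
  disjoint : ∀ {z} → ¬ (z ∈ f x × z ∈ concatMap f xs)
  disjoint (z∈ , z∈') with find (∈-concatMap⁻ f {xs = xs} z∈')
  ... | y , y∈ , z∈y = All.lookup x∉ y∈ (determined (here refl) (there y∈) z∈ z∈y)

map-unique-local : {A B : Set} {f : A → B} (g : B → A) {xs : List A} → Unique xs →
  (∀ {x} → x ∈ xs → g (f x) ≡ x) → Unique (map f xs)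
map-unique-local {f = f} g {xs} uxs gf = Uniqueₚ.map⁻ {f = g} (subst Unique (sym (begin
  map g (map f xs) ≡⟨ map-∘ xs ⟨
  map (g ∘ f) xs   ≡⟨ map-cong-local (All.tabulate gf) ⟩
  map id xs        ≡⟨ map-id xs ⟩
  xs               ∎)) uxs)
  where open ≡-Reasoning

-- The grid of comparators

⊖-scale : ∀ m n k → m ⊖ n ≡ (m + k) ⊖ (n + k)
⊖-scale m n k rewrite +-comm m k | +-comm n k = sym (ℤₚ.+-cancelˡ-⊖ k m n)

⊖-≡⁺ : ∀ {m n o p} → m + p ≡ o + n → m ⊖ n ≡ o ⊖ p
⊖-≡⁺ {m} {n} {o} {p} eq = begin
  m ⊖ n             ≡⟨ ⊖-scale m n p ⟩
  (m + p) ⊖ (n + p) ≡⟨ cong₂ _⊖_ eq (+-comm n p) ⟩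
  (o + n) ⊖ (p + n) ≡⟨ ⊖-scale o p n ⟨
  o ⊖ p             ∎
  where open ≡-Reasoning

⊖-<⁺ : ∀ {m n o p} → m + p < o + n → m ⊖ n ℤ.< o ⊖ p
⊖-<⁺ {m} {n} {o} {p} lt =
  subst₂ ℤ._<_ (sym (⊖-scale m n p)) (trans (cong ((o + n) ⊖_) (+-comm n p)) (sym (⊖-scale o p n)))
    (ℤₚ.⊖-monoˡ-< (n + p) lt)

⊖-≡⁻ : ∀ {m n o p} → m ⊖ n ≡ o ⊖ p → m + p ≡ o + n
⊖-≡⁻ {m} {n} {o} {p} eq with <-cmp (m + p) (o + n)
... | tri< lt _ _ = contradiction eq (ℤₚ.<⇒≢ (⊖-<⁺ {m} {n} {o} {p} lt))
... | tri≈ _ e _  = e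
... | tri> _ _ gt = contradiction (sym eq) (ℤₚ.<⇒≢ (⊖-<⁺ {o} {p} {m} {n} gt))

⊖+1 : ∀ m n → (m ⊖ n) ℤ.+ ℤ.+ 1 ≡ suc m ⊖ n
⊖+1 m n = trans (ℤₚ.distribˡ-⊖-+-pos 1 m n) (cong (_⊖ n) (+-comm m 1))

⊖-1 : ∀ m n → (m ⊖ n) ℤ.- ℤ.+ 1 ≡ m ⊖ suc n
⊖-1 m n = trans (ℤₚ.distribˡ-⊖-+-neg 0 m n) (cong (λ k → m ⊖ suc k) (+-identityʳ n))

data Wire : Set where
  row col : ℕ → Wire

row-injective : ∀ {x y} → row x ≡ row y → x ≡ y
row-injective refl = refl

col-injective : ∀ {x y} → col x ≡ col y → x ≡ y
col-injective refl = refl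

_≟ʷ_ : (v w : Wire) → Dec (v ≡ w)
row x ≟ʷ row y = map′ (cong row) row-injective (x ≟ y)
row x ≟ʷ col y = no λ ()
col x ≟ʷ row y = no λ ()
col x ≟ʷ col y = map′ (cong col) col-injective (x ≟ y)

abstract
  bump : Wire → (Wire → ℕ) → Wire → ℕ
  bump v F w = if does (v ≟ʷ w) then suc (F w) else F w

  bump-≡ : ∀ v F → bump v F v ≡ suc (F v)
  bump-≡ v F with v ≟ʷ v
  ... | yes _  = refl
  ... | no v≢v = contradiction refl v≢v

  bump-≢ : ∀ {v w} F → v ≢ w → bump v F w ≡ F w
  bump-≢ {v} {w} F v≢w with v ≟ʷ w
  ... | yes v≡w = contradiction v≡w v≢w
  ... | no _    = refl

  bump-≥ : ∀ v F w → F w ≤ bump v F w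
  bump-≥ v F w with v ≟ʷ w
  ... | yes _ = n≤1+n _
  ... | no _  = ≤-refl

-- The number of cells already toppled on each wire determines where its chip stands.
position : (Wire → ℕ) → Wire → ℤ
position F (row x) = F (row x) ⊖ x
position F (col y) = y ⊖ F (col y)

position-cong : ∀ {F G} w → F w ≡ G w → position F w ≡ position G w
position-cong (row x) = cong (_⊖ x)
position-cong (col y) = cong (y ⊖_)

chip : (Wire → ℕ) → Wire × ℕ → Chip
chip F (w , l) = position F w , l

fire : ℕ → ℕ → (Wire → ℕ) → Wire → ℕ
fire x y F = bump (row x) (bump (col y) F)

fire-row : ∀ x y F → fire x y F (row x) ≡ suc (F (row x))
fire-row x y F = trans (bump-≡ (row x) (bump (col y) F)) (cong suc (bump-≢ {col y} {row x} F (λ ())))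

fire-col : ∀ x y F → fire x y F (col y) ≡ suc (F (col y))
fire-col x y F = trans (bump-≢ {row x} {col y} (bump (col y) F) (λ ())) (bump-≡ (col y) F)

fire-other : ∀ {x y} F {w} → row x ≢ w → col y ≢ w → fire x y F w ≡ F w
fire-other {x} {y} F r≢ c≢ = trans (bump-≢ (bump (col y) F) r≢) (bump-≢ F c≢)

fire-≥ : ∀ x y F w → F w ≤ fire x y F w
fire-≥ x y F w = ≤-trans (bump-≥ (col y) F w) (bump-≥ (row x) (bump (col y) F) w)

-- Entry i of π starts at position i − a.
wireAt : ℕ → ℕ → Wire
wireAt a i with i ℕ.≤? a
... | yes _ = row (a ∸ i)
... | no _  = col (i ∸ a)

wireAt-≤ : ∀ {a i} → i ≤ a → wireAt a i ≡ row (a ∸ i)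
wireAt-≤ {a} {i} i≤a with i ℕ.≤? a
... | yes _  = refl
... | no i≰a = contradiction i≤a i≰a

wireAt-≰ : ∀ {a i} → ¬ i ≤ a → wireAt a i ≡ col (i ∸ a)
wireAt-≰ {a} {i} i≰a with i ℕ.≤? a
... | yes i≤a = contradiction i≤a i≰a
... | no _    = refl

wireAt-row : ∀ {a x} → x ≤ a → wireAt a (a ∸ x) ≡ row x
wireAt-row {a} {x} x≤a = trans (wireAt-≤ (m∸n≤m a x)) (cong row (m∸[m∸n]≡n x≤a))

wireAt-col : ∀ a y → wireAt a (a + suc y) ≡ col (suc y)
wireAt-col a y = trans (wireAt-≰ (m+1+n≰m a)) (cong col (m+n∸m≡n a (suc y)))

wireAt-injective : ∀ a {i j} → wireAt a i ≡ wireAt a j → i ≡ j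
wireAt-injective a {i} {j} eq with i ℕ.≤? a | j ℕ.≤? a
... | yes p | yes q = ∸-cancelˡ-≡ p q (row-injective eq)
... | no p  | no q  = ∸-cancelʳ-≡ (≰⇒≥ p) (≰⇒≥ q) (col-injective eq)

position-wireAt : ∀ a i → position (λ _ → 0) (wireAt a i) ≡ i ⊖ a
position-wireAt a i with i ℕ.≤? a
... | yes p = ⊖-≡⁺ {0} {a ∸ i} {i} {a} (sym (m+[n∸m]≡n p))
... | no p  = ⊖-≡⁺ {i ∸ a} {0} {i} {a} (trans (m∸n+n≡m (≰⇒≥ p)) (sym (+-identityʳ i)))

relabel-cases : ∀ r x → (x < r × relabel r x ≡ x) ⊎ (r ≤ x × relabel r x ≡ suc x)
relabel-cases r x with x ℕ.<ᵇ r in eq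
... | true  = inj₁ (<ᵇ⇒< x r (subst T (sym eq) _) , refl)
... | false = inj₂ (≮⇒≥ (λ x<r → subst T eq (<⇒<ᵇ x<r)) , refl)

relabel-≥ : ∀ r x → x ≤ relabel r x
relabel-≥ r x with relabel-cases r x
... | inj₁ (_ , e) = ≤-reflexive (sym e)
... | inj₂ (_ , e) = ≤-trans (n≤1+n x) (≤-reflexive (sym e))

relabel-≤ : ∀ r x → relabel r x ≤ suc x
relabel-≤ r x with relabel-cases r x
... | inj₁ (_ , e) = ≤-trans (≤-reflexive e) (n≤1+n x)
... | inj₂ (_ , e) = ≤-reflexive e

relabel-≢ : ∀ r x → r ≢ relabel r x
relabel-≢ r x e with relabel-cases r x
... | inj₁ (x<r , e') = <⇒≢ x<r (trans (sym e') (sym e))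
... | inj₂ (r≤x , e') = <⇒≢ (s≤s r≤x) (trans e e')

relabel-1 : ∀ {x} → 1 ≤ x → relabel 1 x ≡ suc x
relabel-1 {x} 1≤x with relabel-cases 1 x
... | inj₁ (x<1 , _) = contradiction 1≤x (<⇒≱ x<1)
... | inj₂ (_ , e) = e

relabel-fix : ∀ {r x} → x < r → relabel r x ≡ x
relabel-fix {r} {x} x<r with relabel-cases r x
... | inj₁ (_ , e) = e
... | inj₂ (r≤x , _) = contradiction r≤x (<⇒≱ x<r)

relabel-injective : ∀ r {x y} → relabel r x ≡ relabel r y → x ≡ y
relabel-injective r {x} {y} e with relabel-cases r x | relabel-cases r y
... | inj₁ (_ , p)  | inj₁ (_ , q)  = trans (sym p) (trans e q)
... | inj₂ (_ , p)  | inj₂ (_ , q)  = suc-injective (trans (sym p) (trans e q))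
... | inj₁ (lt , p) | inj₂ (ge , q) = contradiction (trans (sym p) (trans e q)) (<⇒≢ (<-trans (<-≤-trans lt ge) ≤-refl))
... | inj₂ (ge , p) | inj₁ (lt , q) = contradiction (sym (trans (sym p) (trans e q))) (<⇒≢ (<-trans (<-≤-trans lt ge) ≤-refl))

relabel-↭ : ∀ {n π r} → 1 ≤ r → r ≤ suc n → IsPerm n π → r ∷ map (relabel r) π ↭ oneTo (suc n)
relabel-↭ {n} {π} {r} 1≤r r≤ perm = ↭-trans (prep r (map⁺ (relabel r) perm))
  (unique-set⇒↭ (All.tabulate fresh ∷ Uniqueₚ.map⁺ (relabel-injective r) (oneTo-unique n)) (oneTo-unique (suc n)) to from)
  where
  fresh : ∀ {z} → z ∈ map (relabel r) (oneTo n) → r ≢ z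
  fresh z∈ with ∈-map⁻ (relabel r) z∈
  ... | x , _ , refl = relabel-≢ r x
  to : ∀ {v} → v ∈ r ∷ map (relabel r) (oneTo n) → v ∈ oneTo (suc n)
  to (here refl) = ∈-oneTo⁺ 1≤r r≤
  to (there v∈) with ∈-map⁻ (relabel r) v∈
  ... | x , x∈ , refl with ∈-oneTo⁻ x∈
  ... | 1≤x , x≤n = ∈-oneTo⁺ (≤-trans 1≤x (relabel-≥ r x)) (≤-trans (relabel-≤ r x) (s≤s x≤n))
  from : ∀ {v} → v ∈ oneTo (suc n) → v ∈ r ∷ map (relabel r) (oneTo n)
  from {v} v∈ with ∈-oneTo⁻ v∈
  from {v} v∈ | 1≤v , v≤ with <-cmp v r
  ... | tri< lt _ _ = there (subst (_∈ map (relabel r) (oneTo n)) (relabel-fix lt)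
          (∈-map⁺ (relabel r) (∈-oneTo⁺ 1≤v (ℕ.s≤s⁻¹ (≤-trans lt r≤)))))
  ... | tri≈ _ refl _ = here refl
  from {suc v} v∈ | 1≤v , v≤ | tri> _ _ (s≤s r≤v) with relabel-cases r v
  ... | inj₁ (lt , _) = contradiction r≤v (<⇒≱ lt)
  ... | inj₂ (_ , e)  = there (subst (_∈ map (relabel r) (oneTo n)) e
          (∈-map⁺ (relabel r) (∈-oneTo⁺ (≤-trans 1≤r r≤v) (ℕ.s≤s⁻¹ v≤))))

indexed : ℕ → List ℕ → List (ℕ × ℕ)
indexed i []       = []
indexed i (x ∷ xs) = (i , x) ∷ indexed (suc i) xs

indexed-proj₁ : ∀ i xs → map proj₁ (indexed i xs) ≡ range i (length xs)
indexed-proj₁ i []       = refl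
indexed-proj₁ i (x ∷ xs) = cong (i ∷_) (indexed-proj₁ (suc i) xs)

indexed-proj₂ : ∀ i xs → map proj₂ (indexed i xs) ≡ xs
indexed-proj₂ i []       = refl
indexed-proj₂ i (x ∷ xs) = cong (x ∷_) (indexed-proj₂ (suc i) xs)

InBand : ℕ → ℕ → ℕ × ℕ → Set
InBand a b (i , x) = x ≤ suc i + b × suc i ≤ x + a

module Grid (a b : ℕ) where

  Valid : Wire → Set
  Valid (row x) = x ≤ a
  Valid (col y) = y ≤ b

  entry-wires : List Wire
  entry-wires = map (wireAt a) (upTo (suc (a + b)))

  wires : List Wire
  wires = col 0 ∷ entry-wires

  col0∉ : All (col 0 ≢_) entry-wires
  col0∉ = All.tabulate λ w∈ eq → absurd w∈ (sym eq)
    where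
    absurd : ∀ {w} → w ∈ entry-wires → w ≢ col 0
    absurd w∈ eq with ∈-map⁻ (wireAt a) {xs = upTo (suc (a + b))} w∈
    ... | i , _ , refl with i ℕ.≤? a
    ... | no p = contradiction (m∸n≡0⇒m≤n (col-injective eq)) p

  wires-unique : Unique wires
  wires-unique = col0∉ ∷ Uniqueₚ.map⁺ (wireAt-injective a) (Uniqueₚ.upTo⁺ _)

  valid⇒∈ : ∀ {w} → Valid w → w ∈ wires
  valid⇒∈ {row x} x≤a = there (subst (_∈ entry-wires) (wireAt-row x≤a)
    (∈-map⁺ (wireAt a) (∈-upTo⁺ (s≤s (≤-trans (m∸n≤m a x) (m≤m+n a b))))))
  valid⇒∈ {col zero} _ = here refl
  valid⇒∈ {col (suc y)} y<b = there (subst (_∈ entry-wires) (wireAt-col a y)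
    (∈-map⁺ (wireAt a) (∈-upTo⁺ (s≤s (+-monoʳ-≤ a y<b)))))

  ∈⇒valid : ∀ {w} → w ∈ wires → Valid w
  ∈⇒valid (here refl) = z≤n
  ∈⇒valid (there w∈) with ∈-map⁻ (wireAt a) {xs = upTo (suc (a + b))} w∈
  ... | i , i∈ , refl with i ℕ.≤? a
  ... | yes _ = m∸n≤m a i
  ... | no p  = ≤-trans (∸-monoˡ-≤ a (<⇒≤pred (∈-upTo⁻ i∈))) (≤-reflexive (m+n∸m≡n a b))

  -- The counts `F` describe a Young diagram of toppled cells: `row⇒col` and `col⇒row` say that row
  -- lengths and column lengths come from the same set of cells. `Inv` is left open so that one
  -- simulation serves the sorting bound and both confinement bounds.
  record State (Inv : Wire → ℕ → ℕ → Set) (c : Config) (F : Wire → ℕ) (d : List (Wire × ℕ)) : Set where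
    field
      config    : c ↭ map (chip F) d
      all-wires : map proj₁ d ↭ wires
      labels    : map proj₂ d ↭ oneTo (suc (suc (a + b)))
      row⇒col   : ∀ {x y} → x ≤ a → y ≤ b → y < F (row x) → x < F (col y)
      col⇒row   : ∀ {x y} → x ≤ a → y ≤ b → x < F (col y) → y < F (row x)
      row≤      : ∀ {x} → x ≤ a → F (row x) ≤ suc b
      col≤      : ∀ {y} → y ≤ b → F (col y) ≤ suc a
      inv       : ∀ {w l} → (w , l) ∈ d → Inv w (F w) l

  -- One comparator at cell (x, y): the row has passed y cells and the column x cells on arrival.
  -- The two alternatives are the two ways in which α and β can arrive.
  Preserved : (Wire → ℕ → ℕ → Set) → Set
  Preserved Inv = ∀ {x y α β} → x ≤ a → y ≤ b → α < β →
    (Inv (row x) y α × Inv (col y) x β) ⊎ (Inv (row x) y β × Inv (col y) x α) →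
    Inv (row x) (suc y) β × Inv (col y) (suc x) α

  module _ {Inv : Wire → ℕ → ℕ → Set} {c : Config} {F : Wire → ℕ} {d : List (Wire × ℕ)} (s : State Inv c F d) where
    open State s

    d-unique : Unique (map proj₁ d)
    d-unique = Unique-resp-↭ (↭-sym all-wires) wires-unique

    ∈⇒Valid : ∀ {w l} → (w , l) ∈ d → Valid w
    ∈⇒Valid wl∈ = ∈⇒valid (∈-resp-↭ all-wires (∈-map⁺ proj₁ wl∈))

    valid⇒label : ∀ {w} → Valid w → ∃ λ l → (w , l) ∈ d
    valid⇒label v with ∈-map⁻ proj₁ (∈-resp-↭ (↭-sym all-wires) (valid⇒∈ v))
    ... | (_ , l) , wl∈ , refl = l , wl∈

    same-wire : ∀ {w l l'} → (w , l) ∈ d → (w , l') ∈ d → l ≡ l'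
    same-wire p q = cong proj₂ (unique-map-injective d-unique p q refl)

    same-label : ∀ {w w' l} → (w , l) ∈ d → (w' , l) ∈ d → w ≡ w'
    same-label p q = cong proj₁ (unique-map-injective (Unique-resp-↭ (↭-sym labels) (oneTo-unique _)) p q refl)

    -- Otherwise the first cell missing from row x would belong to row x', so its column would reach
    -- beyond x' and hence beyond x, and the cell would not be missing.
    row-antitone : ∀ {x x'} → x < x' → x' ≤ a → F (row x') ≤ F (row x)
    row-antitone {x} {x'} x<x' x'≤a = ≮⇒≥ λ lt →
      let y≤b = ℕ.s≤s⁻¹ (≤-trans lt (row≤ x'≤a)) in
      <-irrefl refl (col⇒row (≤-trans (<⇒≤ x<x') x'≤a) y≤b (<-trans x<x' (row⇒col x'≤a y≤b lt)))

    col-antitone : ∀ {y y'} → y < y' → y' ≤ b → F (col y') ≤ F (col y)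
    col-antitone {y} {y'} y<y' y'≤b = ≮⇒≥ λ lt →
      let x≤a = ℕ.s≤s⁻¹ (≤-trans lt (col≤ y'≤b)) in
      <-irrefl refl (row⇒col x≤a (≤-trans (<⇒≤ y<y') y'≤b) (<-trans y<y' (col⇒row x≤a y'≤b lt)))

    row-position-injective : ∀ {x x'} → x ≤ a → x' ≤ a → position F (row x) ≡ position F (row x') → x ≡ x'
    row-position-injective {x} {x'} x≤a x'≤a eq with <-cmp x x'
    ... | tri≈ _ e _ = e
    ... | tri< lt _ _ = contradiction (sym (⊖-≡⁻ {F (row x)} {x} {F (row x')} {x'} eq))
            (<⇒≢ (+-mono-≤-< (row-antitone lt x'≤a) lt))
    ... | tri> _ _ gt = contradiction (⊖-≡⁻ {F (row x)} {x} {F (row x')} {x'} eq)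
            (<⇒≢ (+-mono-≤-< (row-antitone gt x≤a) gt))

    col-position-injective : ∀ {y y'} → y ≤ b → y' ≤ b → position F (col y) ≡ position F (col y') → y ≡ y'
    col-position-injective {y} {y'} y≤b y'≤b eq with <-cmp y y'
    ... | tri≈ _ e _ = e
    ... | tri< lt _ _ = contradiction (⊖-≡⁻ {y} {F (col y)} {y'} {F (col y')} eq)
            (<⇒≢ (+-mono-<-≤ lt (col-antitone lt y'≤b)))
    ... | tri> _ _ gt = contradiction (sym (⊖-≡⁻ {y} {F (col y)} {y'} {F (col y')} eq))
            (<⇒≢ (+-mono-<-≤ gt (col-antitone gt y≤b)))

    -- A common position means that the two counts add up to x + y. If the row fell short of y, cell
    -- (x, y) would be untoppled, so the column would not exceed x and the sum would be too small;
    -- if the row went beyond y, the sum would be too large.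
    meet-at-corner : ∀ {x y} → x ≤ a → y ≤ b → position F (row x) ≡ position F (col y) →
      F (row x) ≡ y × F (col y) ≡ x
    meet-at-corner {x} {y} x≤a y≤b eq with <-cmp (F (row x)) y
    ... | tri≈ _ e _ = e , +-cancelˡ-≡ y (F (col y)) x
            (trans (cong (_+ F (col y)) (sym e)) (⊖-≡⁻ {F (row x)} {x} {y} {F (col y)} eq))
    ... | tri< lt _ _ = contradiction (⊖-≡⁻ {F (row x)} {x} {y} {F (col y)} eq)
            (<⇒≢ (+-mono-<-≤ lt (≮⇒≥ λ x< → <-asym lt (col⇒row x≤a y≤b x<))))
    ... | tri> _ _ gt = contradiction (sym (⊖-≡⁻ {F (row x)} {x} {y} {F (col y)} eq))
            (<⇒≢ (+-mono-< gt (row⇒col x≤a y≤b gt)))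

    fire-row⇒col : ∀ {x y} → F (row x) ≡ y → F (col y) ≡ x →
      ∀ {x' y'} → x' ≤ a → y' ≤ b → y' < fire x y F (row x') → x' < fire x y F (col y')
    fire-row⇒col {x} {y} Fx Fy {x'} {y'} x'≤a y'≤b lt with x ≟ x' | y ≟ y'
    ... | yes refl | yes refl = subst (x <_) (sym (fire-col x y F)) (s≤s (≤-reflexive (sym Fy)))
    ... | yes refl | no y≢y' = ≤-trans (row⇒col x'≤a y'≤b
            (≤∧≢⇒< (ℕ.s≤s⁻¹ (subst (y' <_) (fire-row x y F) lt)) (λ e → y≢y' (trans (sym Fx) (sym e)))))
            (fire-≥ x y F (col y'))
    ... | no x≢x' | _ = ≤-trans (row⇒col x'≤a y'≤b
            (subst (y' <_) (fire-other {x} {y} F (λ e → x≢x' (row-injective e)) (λ ())) lt)) (fire-≥ x y F (col y'))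

    fire-col⇒row : ∀ {x y} → F (row x) ≡ y → F (col y) ≡ x →
      ∀ {x' y'} → x' ≤ a → y' ≤ b → x' < fire x y F (col y') → y' < fire x y F (row x')
    fire-col⇒row {x} {y} Fx Fy {x'} {y'} x'≤a y'≤b lt with y ≟ y' | x ≟ x'
    ... | yes refl | yes refl = subst (y <_) (sym (fire-row x y F)) (s≤s (≤-reflexive (sym Fx)))
    ... | yes refl | no x≢x' = ≤-trans (col⇒row x'≤a y'≤b
            (≤∧≢⇒< (ℕ.s≤s⁻¹ (subst (x' <_) (fire-col x y F) lt)) (λ e → x≢x' (trans (sym Fy) (sym e)))))
            (fire-≥ x y F (row x'))
    ... | no y≢y' | _ = ≤-trans (col⇒row x'≤a y'≤b
            (subst (x' <_) (fire-other {x} {y} F (λ ()) (λ e → y≢y' (col-injective e))) lt)) (fire-≥ x y F (row x'))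

    -- Wires never change their route; only the labels riding on them may be exchanged. `ρ` and `κ`
    -- are the labels arriving on the row and on the column.
    fire-state : Preserved Inv → ∀ {x y ρ κ α β d'} → x ≤ a → y ≤ b → F (row x) ≡ y → F (col y) ≡ x →
      d ↭ (row x , ρ) ∷ (col y , κ) ∷ d' → α < β → (ρ ≡ α × κ ≡ β) ⊎ (ρ ≡ β × κ ≡ α) →
      State Inv ((position F (row x) ℤ.- ℤ.+ 1 , α) ∷ (position F (row x) ℤ.+ ℤ.+ 1 , β) ∷ map (chip F) d')
        (fire x y F) ((col y , α) ∷ (row x , β) ∷ d')
    fire-state pres {x} {y} {ρ} {κ} {α} {β} {d'} x≤a y≤b Fx Fy d↭ α<β ρκ = record
      { config    = ↭-reflexive (cong₂ _∷_ (cong (_, α) col-pos)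
                      (cong₂ _∷_ (cong (_, β) row-pos) (others d' (λ p → p))))
      ; all-wires = ↭-trans (swap (col y) (row x) ↭-refl) (↭-trans (↭-sym (map⁺ proj₁ d↭)) all-wires)
      ; labels    = ↭-trans (new-labels ρκ) (↭-trans (↭-sym (map⁺ proj₂ d↭)) labels)
      ; row⇒col   = fire-row⇒col Fx Fy
      ; col⇒row   = fire-col⇒row Fx Fy
      ; row≤      = new-row≤
      ; col≤      = new-col≤
      ; inv       = new-inv
      }
      where
      F' = fire x y F

      fresh : Unique (map proj₁ ((row x , ρ) ∷ (col y , κ) ∷ d'))
      fresh = Unique-resp-↭ (map⁺ proj₁ d↭) d-unique

      other : ∀ {w l} → (w , l) ∈ d' → F' w ≡ F w
      other wl∈ with fresh
      ... | (_ ∷ r∉) ∷ c∉ ∷ _ = fire-other F (All.lookup r∉ (∈-map⁺ proj₁ wl∈)) (All.lookup c∉ (∈-map⁺ proj₁ wl∈))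

      others : ∀ e → (∀ {z} → z ∈ e → z ∈ d') → map (chip F) e ≡ map (chip F') e
      others [] _ = refl
      others ((w , l) ∷ e) sub = cong₂ _∷_ (cong (_, l) (position-cong w (sym (other (sub (here refl))))))
        (others e (λ p → sub (there p)))

      row-pos : position F (row x) ℤ.+ ℤ.+ 1 ≡ position F' (row x)
      row-pos = trans (⊖+1 (F (row x)) x) (cong (_⊖ x) (sym (fire-row x y F)))

      col-pos : position F (row x) ℤ.- ℤ.+ 1 ≡ position F' (col y)
      col-pos = begin
        position F (row x) ℤ.- ℤ.+ 1 ≡⟨ ⊖-1 (F (row x)) x ⟩
        F (row x) ⊖ suc x          ≡⟨ cong₂ (λ m n → m ⊖ suc n) Fx (sym Fy) ⟩
        y ⊖ suc (F (col y))        ≡⟨ cong (y ⊖_) (sym (fire-col x y F)) ⟩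
        position F' (col y)        ∎
        where open ≡-Reasoning

      new-labels : (ρ ≡ α × κ ≡ β) ⊎ (ρ ≡ β × κ ≡ α) → α ∷ β ∷ map proj₂ d' ↭ ρ ∷ κ ∷ map proj₂ d'
      new-labels (inj₁ (refl , refl)) = ↭-refl
      new-labels (inj₂ (refl , refl)) = swap α β ↭-refl

      new-row≤ : ∀ {x'} → x' ≤ a → F' (row x') ≤ suc b
      new-row≤ {x'} x'≤a with x ≟ x'
      ... | yes refl = subst (_≤ suc b) (sym (trans (fire-row x y F) (cong suc Fx))) (s≤s y≤b)
      ... | no x≢x' = subst (_≤ suc b) (sym (fire-other {x} {y} F (λ e → x≢x' (row-injective e)) (λ ()))) (row≤ x'≤a)

      new-col≤ : ∀ {y'} → y' ≤ b → F' (col y') ≤ suc a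
      new-col≤ {y'} y'≤b with y ≟ y'
      ... | yes refl = subst (_≤ suc a) (sym (trans (fire-col x y F) (cong suc Fy))) (s≤s x≤a)
      ... | no y≢y' = subst (_≤ suc a) (sym (fire-other {x} {y} F (λ ()) (λ e → y≢y' (col-injective e)))) (col≤ y'≤b)

      old-row : Inv (row x) y ρ
      old-row = subst (λ h → Inv (row x) h ρ) Fx (inv (∈-resp-↭ (↭-sym d↭) (here refl)))

      old-col : Inv (col y) x κ
      old-col = subst (λ h → Inv (col y) h κ) Fy (inv (∈-resp-↭ (↭-sym d↭) (there (here refl))))

      old : (ρ ≡ α × κ ≡ β) ⊎ (ρ ≡ β × κ ≡ α) →
        (Inv (row x) y α × Inv (col y) x β) ⊎ (Inv (row x) y β × Inv (col y) x α)
      old (inj₁ (refl , refl)) = inj₁ (old-row , old-col)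
      old (inj₂ (refl , refl)) = inj₂ (old-row , old-col)

      new-inv : ∀ {w l} → (w , l) ∈ (col y , α) ∷ (row x , β) ∷ d' → Inv w (F' w) l
      new-inv (here refl) = subst (λ h → Inv (col y) h α) (sym (trans (fire-col x y F) (cong suc Fy)))
        (proj₂ (pres x≤a y≤b α<β (old ρκ)))
      new-inv (there (here refl)) = subst (λ h → Inv (row x) h β) (sym (trans (fire-row x y F) (cong suc Fx)))
        (proj₁ (pres x≤a y≤b α<β (old ρκ)))
      new-inv {w} {l} (there (there wl∈)) = subst (λ h → Inv w h l) (sym (other wl∈))
        (inv (∈-resp-↭ (↭-sym d↭) (there (there wl∈))))

    split-pair : ∀ {i α β rest} ys → (i , α) ∷ (i , β) ∷ rest ≡ map (chip F) ys →
      ∃ λ v → ∃ λ w → ∃ λ d' → ys ≡ (v , α) ∷ (w , β) ∷ d' ×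
        position F v ≡ i × position F w ≡ i × rest ≡ map (chip F) d'
    split-pair (_ ∷ _ ∷ d') eq with ∷-injective eq
    ... | refl , eq' with ∷-injective eq'
    ... | e , refl = _ , _ , d' , cong (λ l → _ ∷ (_ , l) ∷ d') (sym (cong proj₂ e)) , refl , sym (cong proj₁ e) , refl

    -- Any legal move is a comparator of the grid: two rows, or two columns, never share a position,
    -- so the chosen chips are a row and a column meeting at a corner.
    move-state : Preserved Inv → ∀ {c'} → Move c c' → ∃ λ F' → ∃ λ d' → State Inv c' F' d'
    move-state pres (topple _ rest i α β α<β c↭) with ↭-map-inv (chip F) (↭-trans (↭-sym config) c↭)
    ... | ys , eq , d↭ with split-pair ys eq
    ... | v , w , d' , refl , pv , pw , refl = fired v w d↭ pv pw
      where
      first : ∀ {v w d'} → d ↭ (v , α) ∷ (w , β) ∷ d' → Valid v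
      first d↭ = ∈⇒Valid (∈-resp-↭ (↭-sym d↭) (here refl))
      second : ∀ {v w d'} → d ↭ (v , α) ∷ (w , β) ∷ d' → Valid w
      second d↭ = ∈⇒Valid (∈-resp-↭ (↭-sym d↭) (there (here refl)))
      distinct : ∀ {v w d'} → d ↭ (v , α) ∷ (w , β) ∷ d' → v ≢ w
      distinct d↭ with Unique-resp-↭ (map⁺ proj₁ d↭) d-unique
      ... | (v≢w ∷ _) ∷ _ = v≢w
      fired : ∀ v w {d'} → d ↭ (v , α) ∷ (w , β) ∷ d' → position F v ≡ i → position F w ≡ i →
        ∃ λ F' → ∃ λ d'' → State Inv ((i ℤ.- ℤ.+ 1 , α) ∷ (i ℤ.+ ℤ.+ 1 , β) ∷ map (chip F) d') F' d''
      fired (row x) (row x') d↭ pv pw =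
        contradiction (cong row (row-position-injective (first d↭) (second d↭) (trans pv (sym pw)))) (distinct d↭)
      fired (col y) (col y') d↭ pv pw =
        contradiction (cong col (col-position-injective (first d↭) (second d↭) (trans pv (sym pw)))) (distinct d↭)
      fired (row x) (col y) d↭ refl pw =
        let Fx , Fy = meet-at-corner (first d↭) (second d↭) (sym pw) in
        _ , _ , fire-state pres (first d↭) (second d↭) Fx Fy d↭ α<β (inj₁ (refl , refl))
      fired (col y) (row x) d↭ pv refl =
        let Fx , Fy = meet-at-corner (second d↭) (first d↭) (sym pv) in
        _ , _ , fire-state pres (second d↭) (first d↭) Fx Fy (↭-trans d↭ (swap _ _ ↭-refl)) α<β (inj₂ (refl , refl))

    -- The full rows before x push every column at least to height x, and the first cell missing
    -- from row x stops its column there.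
    corner-below-full-rows : ∀ {x} → x ≤ a → (∀ {x'} → x' < x → F (row x') ≡ suc b) → F (row x) ≤ b →
      F (col (F (row x))) ≡ x
    corner-below-full-rows {x} x≤a full y≤b = ≤-antisym
      (≮⇒≥ λ lt → <-irrefl refl (col⇒row x≤a y≤b lt))
      (≮⇒≥ λ lt → <-irrefl refl
        (row⇒col (≤-trans (<⇒≤ lt) x≤a) y≤b (subst (F (row x) <_) (sym (full lt)) (s≤s y≤b))))

    corner-positions : ∀ {x y} → F (row x) ≡ y → F (col y) ≡ x → position F (row x) ≡ position F (col y)
    corner-positions {x} {y} Fx Fy = cong₂ _⊖_ Fx (sym Fy)

    pair-on : ∀ {v w} → Valid v → Valid w → v ≢ w →
      ∃ λ ρ → ∃ λ κ → ∃ λ d' → ρ ≢ κ × d ↭ (v , ρ) ∷ (w , κ) ∷ d'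
    pair-on {v} {w} vv vw v≢w with valid⇒label vv | valid⇒label vw
    ... | ρ , vρ∈ | κ , wκ∈ with ∈⇒↭∷ vρ∈
    ... | e , d↭ with ∈-resp-↭ d↭ wκ∈
    ... | here refl = contradiction refl v≢w
    ... | there wκ∈e with ∈⇒↭∷ wκ∈e
    ... | d' , e↭ = ρ , κ , d' , (λ { refl → v≢w (same-label vρ∈ wκ∈) }) , ↭-trans d↭ (prep _ e↭)

    -- The first row that is not full would have its chip waiting at the position of a column chip,
    -- against stability.
    stable⇒row-full : Stable c → ∀ {x} → Acc _<_ x → x ≤ a → F (row x) ≡ suc b
    stable⇒row-full stable {x} (acc rec) x≤a with m≤n⇒m<n∨m≡n (row≤ x≤a)
    ... | inj₂ e = e
    ... | inj₁ (s≤s y≤b)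
      with Fy ← corner-below-full-rows x≤a (λ lt → stable⇒row-full stable (rec lt) (≤-trans (<⇒≤ lt) x≤a)) y≤b
      with pair-on {row x} {col (F (row x))} x≤a y≤b (λ ())
    ... | _ , _ , _ , _ , d↭
      with Unique-resp-↭ (map⁺ proj₁ (↭-trans config (map⁺ (chip F) d↭))) stable
    ... | (p≢ ∷ _) ∷ _ = contradiction (corner-positions {x} refl Fy) p≢

    rows-full⇒col-full : (∀ {x} → x ≤ a → F (row x) ≡ suc b) → ∀ {y} → y ≤ b → F (col y) ≡ suc a
    rows-full⇒col-full full {y} y≤b = ≤-antisym (col≤ y≤b)
      (row⇒col ≤-refl y≤b (subst (y <_) (sym (full ≤-refl)) (s≤s y≤b)))

  moves-state : ∀ {Inv} → Preserved Inv → ∀ {c c' F d} → State Inv c F d → Star Move c c' →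
    ∃ λ F' → ∃ λ d' → State Inv c' F' d'
  moves-state pres s ε = _ , _ , s
  moves-state pres s (m ◅ ms) with move-state s pres m
  ... | _ , _ , s' = moves-state pres s' ms

  Reachable : (Wire → ℕ → ℕ → Set) → Config → ℕ → Set
  Reachable Inv c x = ∃ λ c' → ∃ λ F → ∃ λ d → Star Move c c' × State Inv c' F d × (∀ {x'} → x' < x → F (row x') ≡ suc b)

  module _ {Inv : Wire → ℕ → ℕ → Set} (pres : Preserved Inv) where

    topple-corner : ∀ {c F d x} → State Inv c F d → x ≤ a → (∀ {x'} → x' < x → F (row x') ≡ suc b) → F (row x) ≤ b →
      ∃ λ c' → ∃ λ d' → Move c c' × State Inv c' (fire x (F (row x)) F) d'
    topple-corner {c} {F} {d} {x} s x≤a full y≤b = fire-pair (pair-on s {row x} {col (F (row x))} x≤a y≤b (λ ()))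
      where
      Fy : F (col (F (row x))) ≡ x
      Fy = corner-below-full-rows s x≤a full y≤b
      i : ℤ
      i = position F (row x)
      fire-pair : (∃ λ ρ → ∃ λ κ → ∃ λ d' → ρ ≢ κ × d ↭ (row x , ρ) ∷ (col (F (row x)) , κ) ∷ d') →
        ∃ λ c' → ∃ λ d' → Move c c' × State Inv c' (fire x (F (row x)) F) d'
      fire-pair (ρ , κ , d' , ρ≢κ , d↭) = by-order (<-cmp ρ κ)
        where
        at-corner : c ↭ (i , ρ) ∷ (i , κ) ∷ map (chip F) d'
        at-corner = ↭-trans (State.config s) (↭-trans (map⁺ (chip F) d↭)
          (↭-reflexive (cong (λ p → (i , ρ) ∷ (p , κ) ∷ map (chip F) d') (sym (corner-positions s {x} refl Fy)))))
        by-order : Tri (ρ < κ) (ρ ≡ κ) (κ < ρ) → ∃ λ c' → ∃ λ d' → Move c c' × State Inv c' (fire x (F (row x)) F) d'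
        by-order (tri≈ _ e _)  = contradiction e ρ≢κ
        by-order (tri< lt _ _) = _ , _ , topple c (map (chip F) d') i ρ κ lt at-corner ,
          fire-state s pres x≤a y≤b refl Fy d↭ lt (inj₁ (refl , refl))
        by-order (tri> _ _ gt) = _ , _ , topple c (map (chip F) d') i κ ρ gt (↭-trans at-corner (swap _ _ ↭-refl)) ,
          fire-state s pres x≤a y≤b refl Fy d↭ gt (inj₂ (refl , refl))

    extend-full : ∀ {F : Wire → ℕ} {x} → (∀ {x'} → x' < x → F (row x') ≡ suc b) → F (row x) ≡ suc b →
      ∀ {x'} → x' < suc x → F (row x') ≡ suc b
    extend-full full e (s≤s x'≤x) with m≤n⇒m<n∨m≡n x'≤x
    ... | inj₁ lt   = full lt
    ... | inj₂ refl = e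

    prepend : ∀ {c c' x} → Star Move c c' → Reachable Inv c' x → Reachable Inv c x
    prepend ms (c'' , F , d , ms' , r) = c'' , F , d , ms ◅◅ ms' , r

    fill-row : ∀ {c F d x} t → State Inv c F d → x ≤ a → (∀ {x'} → x' < x → F (row x') ≡ suc b) →
      F (row x) + t ≡ suc b → Reachable Inv c (suc x)
    fill-row {c} {F} {d} {x} zero s x≤a full e = c , F , d , ε , s , extend-full {F} full (trans (sym (+-identityʳ _)) e)
    fill-row {c} {F} {d} {x} (suc t) s x≤a full e = continue (topple-corner s x≤a full y≤b)
      where
      e' : suc (F (row x)) + t ≡ suc b
      e' = trans (sym (+-suc (F (row x)) t)) e
      y≤b : F (row x) ≤ b
      y≤b = ≤-trans (m≤m+n _ t) (≤-reflexive (suc-injective e'))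
      continue : (∃ λ c' → ∃ λ d' → Move c c' × State Inv c' (fire x (F (row x)) F) d') → Reachable Inv c (suc x)
      continue (c' , d' , m , s') = prepend (m ◅ ε) (fill-row {x = x} t s' x≤a
        (λ {x'} lt → trans (fire-other {x} {F (row x)} F (λ eq → <⇒≢ lt (sym (row-injective eq))) (λ ())) (full lt))
        (trans (cong (_+ t) (fire-row x (F (row x)) F)) e'))

    -- Working row by row keeps the next cell of the current row available throughout, by
    -- `corner-below-full-rows`.
    fill-rows : ∀ {c F d} x → State Inv c F d → x ≤ suc a → Reachable Inv c x
    fill-rows zero s _ = _ , _ , _ , ε , s , λ ()
    fill-rows {c} (suc x) s x<a = continue (fill-rows x s (≤-trans (n≤1+n x) x<a))
      where
      continue : Reachable Inv c x → Reachable Inv c (suc x)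
      continue (c' , F , d , ms , s' , full) = prepend ms
        (fill-row (suc b ∸ F (row x)) s' (ℕ.s≤s⁻¹ x<a) full (m+[n∸m]≡n (State.row≤ s' (ℕ.s≤s⁻¹ x<a))))

-- Toppleable permutations are the permutations in a band

  N : ℕ
  N = suc (suc (a + b))

  start : ℕ → List ℕ → Config
  start r π = (ℤ.+ 0 , r) ∷ place r (ℤ.- (ℤ.+ a)) π

  entry : ℕ → ℕ × ℕ → Wire × ℕ
  entry r (i , x) = wireAt a i , relabel r x

  place-entries : ∀ r i xs → place r (i ⊖ a) xs ≡ map (chip (λ _ → 0)) (map (entry r) (indexed i xs))
  place-entries r i []       = refl
  place-entries r i (x ∷ xs) = cong₂ _∷_ (cong (_, relabel r x) (sym (position-wireAt a i)))
    (trans (cong (λ p → place r p xs) (⊖+1 i a)) (place-entries r (suc i) xs))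

  module _ {π : List ℕ} (perm : IsPerm (suc (a + b)) π) where

    entry-index : ∀ {i x} → (i , x) ∈ indexed 0 π → i ≤ a + b
    entry-index ix∈ with subst (_ ∈_) (trans (indexed-proj₁ 0 π) (sym (upTo-range (length π)))) (∈-map⁺ proj₁ ix∈)
    ... | i∈ = ℕ.s≤s⁻¹ (subst (_ <_) (perm-length perm) (∈-upTo⁻ i∈))

    entry-value : ∀ {i x} → (i , x) ∈ indexed 0 π → 1 ≤ x × x ≤ suc (a + b)
    entry-value ix∈ = ∈-oneTo⁻ (∈-resp-↭ perm (subst (_ ∈_) (indexed-proj₂ 0 π) (∈-map⁺ proj₂ ix∈)))

    entry-unique : ∀ {i j x} → (i , x) ∈ indexed 0 π → (j , x) ∈ indexed 0 π → i ≡ j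
    entry-unique ix∈ jx∈ = cong proj₁ (unique-map-injective
      (subst Unique (sym (indexed-proj₂ 0 π)) (Unique-resp-↭ (↭-sym perm) (oneTo-unique _))) ix∈ jx∈ refl)

    start-state : ∀ {Inv r} → 1 ≤ r → r ≤ N → Inv (col 0) 0 r →
      (∀ {i x} → (i , x) ∈ indexed 0 π → Inv (wireAt a i) 0 (relabel r x)) →
      State Inv (start r π) (λ _ → 0) ((col 0 , r) ∷ map (entry r) (indexed 0 π))
    start-state {Inv} {r} 1≤r r≤N inv0 inv+ = record
      { config    = ↭-reflexive (cong ((ℤ.+ 0 , r) ∷_)
                      (trans (cong (λ p → place r p π) (sym (ℤₚ.⊖-≤ {0} {a} z≤n))) (place-entries r 0 π)))
      ; all-wires = ↭-reflexive (cong (col 0 ∷_) start-wires)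
      ; labels    = ↭-trans (↭-reflexive (cong (r ∷_) start-labels)) (relabel-↭ 1≤r r≤N perm)
      ; row⇒col   = λ _ _ ()
      ; col⇒row   = λ _ _ ()
      ; row≤      = λ _ → z≤n
      ; col≤      = λ _ → z≤n
      ; inv       = inv
      }
      where
      open ≡-Reasoning
      start-wires : map proj₁ (map (entry r) (indexed 0 π)) ≡ entry-wires
      start-wires = begin
        map proj₁ (map (entry r) (indexed 0 π))   ≡⟨ map-∘ (indexed 0 π) ⟨
        map (wireAt a ∘ proj₁) (indexed 0 π)      ≡⟨ map-∘ (indexed 0 π) ⟩
        map (wireAt a) (map proj₁ (indexed 0 π))  ≡⟨ cong (map (wireAt a)) (trans (indexed-proj₁ 0 π) (sym (upTo-range (length π)))) ⟩
        map (wireAt a) (upTo (length π))          ≡⟨ cong (map (wireAt a) ∘ upTo) (perm-length perm) ⟩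
        entry-wires                           ∎
      start-labels : map proj₂ (map (entry r) (indexed 0 π)) ≡ map (relabel r) π
      start-labels = begin
        map proj₂ (map (entry r) (indexed 0 π))   ≡⟨ map-∘ (indexed 0 π) ⟨
        map (relabel r ∘ proj₂) (indexed 0 π)     ≡⟨ map-∘ (indexed 0 π) ⟩
        map (relabel r) (map proj₂ (indexed 0 π)) ≡⟨ cong (map (relabel r)) (indexed-proj₂ 0 π) ⟩
        map (relabel r) π                         ∎
      inv : ∀ {w l} → (w , l) ∈ (col 0 , r) ∷ map (entry r) (indexed 0 π) → Inv w 0 l
      inv (here refl) = inv0
      inv (there wl∈) with ∈-map⁻ (entry r) wl∈
      ... | _ , ix∈ , refl = inv+ ix∈

  -- Sufficiency of the band: the network sorts

  Sorts : ℕ → List ℕ → Set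
  Sorts r π = ∃ λ c → Star Move (start r π) c × Stable c × ReadsAs c (oneTo N)

  -- Where row x meets column y, both bounds say x + l ≤ N and y < l on either wire.  Afterwards the
  -- first must be sharper for the smaller chip and the second for the larger one, so α < β suffices.
  SortInv : Wire → ℕ → ℕ → Set
  SortInv (row x) h l = x + l ≤ N × suc h ≤ l
  SortInv (col y) h l = h + l ≤ N × suc y ≤ l

  SortInv-preserved : Preserved SortInv
  SortInv-preserved {x} _ _ α<β (inj₁ ((_ , y<α) , (x+β , y<β))) =
    (x+β , ≤-<-trans y<α α<β) , (≤-trans (≤-trans (≤-reflexive (sym (+-suc x _))) (+-monoʳ-≤ x α<β)) x+β , y<α)
  SortInv-preserved {x} _ _ α<β (inj₂ ((x+β , y<β) , (_ , y<α))) =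
    (x+β , ≤-<-trans y<α α<β) , (≤-trans (≤-trans (≤-reflexive (sym (+-suc x _))) (+-monoʳ-≤ x α<β)) x+β , y<α)

  -- Full columns end at y - a - 1 and full rows at b + 1 - x. Together these are all positions from
  -- -a - 1 to b + 1 except b - a, which stays empty; hence the jump after label b + 1.
  target : ℕ → ℤ
  target l with l ℕ.≤? suc b
  ... | yes _ = l ⊖ suc (suc a)
  ... | no _  = l ⊖ suc a

  target-< : ∀ l → target l ℤ.< target (suc l)
  target-< l with l ℕ.≤? suc b | suc l ℕ.≤? suc b
  ... | yes _ | yes _ = ⊖-<⁺ {l} {suc (suc a)} {suc l} ≤-refl
  ... | yes _ | no _  = ⊖-<⁺ {l} {suc (suc a)} {suc l} {suc a} (+-mono-≤-< {l} (n≤1+n l) ≤-refl)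
  ... | no ¬p | yes p = contradiction (≤-trans (n≤1+n l) p) ¬p
  ... | no _  | no _  = ⊖-<⁺ {l} {suc a} {suc l} ≤-refl

  module _ {c F d} (s : State SortInv c F d) (full : ∀ {x} → x ≤ a → F (row x) ≡ suc b) where
    open State s

    -- At full height the invariant separates the labels: those beyond b + 1 lie on rows, the others
    -- on columns.
    row-bounds : ∀ {x l} → (row x , l) ∈ d → x + l ≤ N × suc (suc b) ≤ l
    row-bounds wl∈ with inv wl∈
    ... | p , q = p , subst (λ h → suc h ≤ _) (full (∈⇒Valid s wl∈)) q

    col-bounds : ∀ {y l} → (col y , l) ∈ d → l ≤ suc b × suc y ≤ l
    col-bounds wl∈ with inv wl∈
    ... | p , q = +-cancelˡ-≤ (suc a) _ _ (≤-trans
                    (subst (λ h → h + _ ≤ N) (rows-full⇒col-full s full (∈⇒Valid s wl∈)) p)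
                    (≤-reflexive (cong suc (sym (+-suc a b))))) , q

    on-wire : ∀ {l} → 1 ≤ l → l ≤ N → ∃ λ w → (w , l) ∈ d
    on-wire 1≤l l≤N with ∈-map⁻ proj₂ (∈-resp-↭ (↭-sym labels) (∈-oneTo⁺ 1≤l l≤N))
    ... | (w , _) , wl∈ , refl = w , wl∈

    row<N : ∀ {x} → x ≤ a → x ≤ N
    row<N x≤a = ≤-trans x≤a (≤-trans (m≤m+n a b) (≤-trans (n≤1+n _) (n≤1+n _)))

    N∸row : ∀ {x} → x ≤ a → suc (suc b) ≤ N ∸ x
    N∸row {x} x≤a = m+n≤o⇒m≤o∸n (suc (suc b))
      (≤-trans (+-monoʳ-≤ (suc (suc b)) x≤a) (≤-reflexive (cong (2 +_) (+-comm b a))))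

    -- Labels are located from the largest down. N - x is too large for a column, the invariant
    -- admits it only on rows up to x, and the earlier rows already carry larger labels. `col-label`
    -- runs the same argument from the smallest label up.
    row-label : ∀ {x l} → Acc _<_ x → (row x , l) ∈ d → x + l ≡ N
    row-label {x} {l} (acc rec) wl∈ with on-wire {N ∸ x} (≤-trans (s≤s z≤n) (N∸row (∈⇒Valid s wl∈))) (m∸n≤m N x)
    ... | col y , m∈ = contradiction (proj₁ (col-bounds m∈)) (<⇒≱ (N∸row (∈⇒Valid s wl∈)))
    ... | row x' , m∈ with m≤n⇒m<n∨m≡n (+-cancelʳ-≤ (N ∸ x) x' x
            (≤-trans (proj₁ (row-bounds m∈)) (≤-reflexive (sym (m+[n∸m]≡n (row<N (∈⇒Valid s wl∈)))))))
    ... | inj₁ lt = contradiction (+-cancelʳ-≡ (N ∸ x) x' x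
            (trans (row-label (rec lt) m∈) (sym (m+[n∸m]≡n (row<N (∈⇒Valid s wl∈)))))) (<⇒≢ lt)
    ... | inj₂ refl = trans (cong (x +_) (same-wire s wl∈ m∈)) (m+[n∸m]≡n (row<N (∈⇒Valid s wl∈)))

    col-label : ∀ {y l} → Acc _<_ y → (col y , l) ∈ d → l ≡ suc y
    col-label {y} {l} (acc rec) wl∈ with on-wire {suc y} (s≤s z≤n) (s≤s (≤-trans (∈⇒Valid s wl∈) (≤-trans (m≤n+m b a) (n≤1+n _))))
    ... | row x , m∈ = contradiction (∈⇒Valid s wl∈) (<⇒≱ (ℕ.s≤s⁻¹ (proj₂ (row-bounds m∈))))
    ... | col y' , m∈ with m≤n⇒m<n∨m≡n (ℕ.s≤s⁻¹ (proj₂ (col-bounds m∈)))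
    ... | inj₁ lt   = contradiction (suc-injective (col-label (rec lt) m∈)) (λ e → <⇒≢ lt (sym e))
    ... | inj₂ refl = same-wire s wl∈ m∈

    position-target : ∀ {w l} → (w , l) ∈ d → position F w ≡ target l
    position-target {row x} {l} wl∈ with l ℕ.≤? suc b
    ... | yes p = contradiction p (<⇒≱ (proj₂ (row-bounds wl∈)))
    ... | no _  = trans (cong (_⊖ x) (full (∈⇒Valid s wl∈))) (⊖-≡⁺ {suc b} {x} {l} {suc a}
            (trans (trans (cong suc (trans (+-suc b a) (cong suc (+-comm b a)))) (sym (row-label (<-wellFounded x) wl∈))) (+-comm x l)))
    position-target {col y} {l} wl∈ with l ℕ.≤? suc b
    ... | no ¬p = contradiction (proj₁ (col-bounds wl∈)) ¬p
    ... | yes _ = trans (cong (y ⊖_) (rows-full⇒col-full s full (∈⇒Valid s wl∈))) (⊖-≡⁺ {y} {suc a} {l} {suc (suc a)}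
            (trans (+-suc y (suc a)) (cong (_+ suc a) (sym (col-label (<-wellFounded y) wl∈)))))

    final : Config
    final = map (λ l → target l , l) (oneTo N)

    final-↭ : final ↭ c
    final-↭ = ↭-sym (↭-trans config (↭-trans (↭-reflexive
      (trans (map-cong-local (All.tabulate (λ { {w , l} wl∈ → cong (_, l) (position-target wl∈) }))) (map-∘ d)))
      (map⁺ _ labels)))

    final-linked : Linked (λ p q → proj₁ p ℤ.< proj₁ q) final
    final-linked = Linkedₚ.map⁺ (Linkedₚ.map⁺ (Linkedₚ.applyUpTo⁺₂ id N (λ i → target-< (suc i))))

    final-reads : ReadsAs c (oneTo N)
    final-reads = final , final-↭ , final-linked , trans (sym (map-∘ (oneTo N))) (map-id (oneTo N))

    final-stable : Stable c
    final-stable = Unique-resp-↭ (map⁺ proj₁ final-↭)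
      (AllPairsₚ.map⁺ (AllPairs.map ℤₚ.<⇒≢ (Linkedₚ.Linked⇒AllPairs ℤₚ.<-trans final-linked)))

  -- At height 0 the invariant on row a - i is the upper band inequality, with the label possibly
  -- raised by one, and on column i - a it is the lower one. The other bound on each wire only says
  -- that labels lie in 1, ..., N.
  in-band⇒sorts : ∀ {π r} → IsPerm (suc (a + b)) π → 1 ≤ r → r ≤ N → All (InBand a b) (indexed 0 π) → Sorts r π
  in-band⇒sorts {π} {r} perm 1≤r r≤N band = sorted
    (fill-rows SortInv-preserved (suc a) (start-state perm {SortInv} 1≤r r≤N (r≤N , 1≤r) entry-inv) ≤-refl)
    where
    sorted : Reachable SortInv (start r π) (suc a) → Sorts r π
    sorted (_ , _ , _ , ms , s , full) = _ , ms , final-stable s (full ∘ s≤s) , final-reads s (full ∘ s≤s)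
    entry-inv : ∀ {i x} → (i , x) ∈ indexed 0 π → SortInv (wireAt a i) 0 (relabel r x)
    entry-inv {i} {x} ix∈ with All.lookup band ix∈ | entry-value perm ix∈ | i ℕ.≤? a
    ... | x≤ , _ | 1≤x , _ | yes i≤a = (begin
            (a ∸ i) + relabel r x             ≤⟨ +-monoʳ-≤ (a ∸ i) (≤-trans (relabel-≤ r x) (s≤s x≤)) ⟩
            (a ∸ i) + suc (suc i + b)         ≡⟨ trans (+-suc (a ∸ i) _) (cong suc (+-suc (a ∸ i) _)) ⟩
            suc (suc ((a ∸ i) + (i + b)))     ≡⟨ cong (2 +_) (trans (sym (+-assoc (a ∸ i) i b)) (cong (_+ b) (m∸n+n≡m i≤a))) ⟩
            N                                 ∎) , ≤-trans 1≤x (relabel-≥ r x)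
      where open ≤-Reasoning
    ... | _ , i< | _ , x≤n | no i≰a = ≤-trans (relabel-≤ r x) (s≤s x≤n) ,
            ≤-trans (≤-trans (≤-reflexive (sym (+-∸-assoc 1 (≰⇒≥ i≰a)))) (m≤n+o⇒m∸n≤o (suc i) a (≤-trans i< (≤-reflexive (+-comm x a))))) (relabel-≥ r x)

  -- Necessity of the band: confinement of a single chip

  module _ {Inv c F d} (s : State Inv c F d) (full : ∀ {x} → x ≤ a → F (row x) ≡ suc b) (reads : ReadsAs c (oneTo N)) where
    open State s

    label-in-range : ∀ {w l} → (w , l) ∈ d → 1 ≤ l × l ≤ N
    label-in-range wl∈ = ∈-oneTo⁻ (∈-resp-↭ labels (∈-map⁺ proj₂ wl∈))

    -- The listing that reads the identity increases in position and in label at once, so comparing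
    -- two positions compares the labels.
    position-<⇒label-< : ∀ {v w k l} → (v , k) ∈ d → (w , l) ∈ d → position F v ℤ.< position F w → k < l
    position-<⇒label-< {v} {w} {k} {l} vk∈ wl∈ lt = ordered
          (AllPairs.zip (Linkedₚ.Linked⇒AllPairs ℤₚ.<-trans linked , AllPairsₚ.map⁻ (subst (AllPairs _<_) (sym read) oneTo-sorted)))
          (in-t vk∈) (in-t wl∈) lt
      where
      t = proj₁ reads
      t↭c = proj₁ (proj₂ reads)
      linked = proj₁ (proj₂ (proj₂ reads))
      read = proj₂ (proj₂ (proj₂ reads))
      oneTo-sorted : AllPairs _<_ (oneTo N)
      oneTo-sorted = AllPairsₚ.map⁺ (AllPairsₚ.applyUpTo⁺₁ id N (λ i<j _ → s≤s i<j))
      in-t : ∀ {w l} → (w , l) ∈ d → (position F w , l) ∈ t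
      in-t wl∈ = ∈-resp-↭ (↭-sym (↭-trans t↭c config)) (∈-map⁺ (chip F) wl∈)
      ordered : ∀ {u} {p q : Chip} → AllPairs (λ p q → proj₁ p ℤ.< proj₁ q × proj₂ p < proj₂ q) u →
        p ∈ u → q ∈ u → proj₁ p ℤ.< proj₁ q → proj₂ p < proj₂ q
      ordered (_ ∷ _)  (here refl) (here refl) p<q = contradiction p<q (ℤₚ.<-irrefl refl)
      ordered (px ∷ _) (here refl) (there q)   _   = proj₂ (All.lookup px q)
      ordered (px ∷ _) (there p)   (here refl) p<q = contradiction p<q (ℤₚ.<-asym (proj₁ (All.lookup px p)))
      ordered (_ ∷ ps) (there p)   (there q)   p<q = ordered ps p q p<q

    -- From row 0 onwards the final positions strictly decrease, so the labels, at most N on row 0,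
    -- drop by at least one per row.
    row-label-≤ : ∀ x {l} → (row x , l) ∈ d → l + x ≤ N
    row-label-≤ zero {l} wl∈ = ≤-trans (≤-reflexive (+-identityʳ l)) (proj₂ (label-in-range wl∈))
    row-label-≤ (suc x) {l} wl∈ with valid⇒label s {row x} (<⇒≤ (∈⇒Valid s wl∈))
    ... | m , xm∈ = ≤-trans (≤-reflexive (+-suc l x)) (≤-trans (+-monoˡ-≤ x (position-<⇒label-< wl∈ xm∈
            (subst₂ (λ h h' → h ⊖ suc x ℤ.< h' ⊖ x) (sym (full (∈⇒Valid s wl∈))) (sym (full (∈⇒Valid s xm∈)))
              (⊖-<⁺ {suc b} {suc x} {suc b} {x} (+-monoʳ-< (suc b) ≤-refl))))) (row-label-≤ x xm∈))

    col-label-≥ : ∀ y {l} → (col y , l) ∈ d → suc y ≤ l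
    col-label-≥ zero wl∈ = proj₁ (label-in-range wl∈)
    col-label-≥ (suc y) wl∈ with valid⇒label s {col y} (<⇒≤ (∈⇒Valid s wl∈))
    ... | m , ym∈ = ≤-<-trans (col-label-≥ y ym∈) (position-<⇒label-< ym∈ wl∈
            (subst₂ (λ h h' → y ⊖ h ℤ.< suc y ⊖ h') (sym (rows-full⇒col-full s full (∈⇒Valid s ym∈)))
              (sym (rows-full⇒col-full s full (∈⇒Valid s wl∈))) (⊖-<⁺ {y} {suc a} {suc y} {suc a} ≤-refl)))

    -- Full columns end at b - a - 1 or to the left of it, full rows at b - a + 1 or to the right of
    -- it.
    col-label<row-label : ∀ {x y k l} → (col y , k) ∈ d → (row x , l) ∈ d → k < l
    col-label<row-label {x} {y} yk∈ xl∈ = position-<⇒label-< yk∈ xl∈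
      (subst₂ (λ h h' → y ⊖ h ℤ.< h' ⊖ x) (sym (rows-full⇒col-full s full (∈⇒Valid s yk∈))) (sym (full (∈⇒Valid s xl∈)))
        (⊖-<⁺ {y} {suc a} {suc b} {x} (+-mono-<-≤ (s≤s (∈⇒Valid s yk∈)) (≤-trans (∈⇒Valid s xl∈) (n≤1+n a)))))

  -- A chip starting on row r can leave it only downwards, into later rows.
  BeyondRow : ℕ → Wire → ℕ → Set
  BeyondRow r (row x) h = r ≤ x
  BeyondRow r (col y) h = r < h

  BeyondCol : ℕ → Wire → ℕ → Set
  BeyondCol c (row x) h = c < h
  BeyondCol c (col y) h = c ≤ y

  RowInv : ℕ → ℕ → Wire → ℕ → ℕ → Set
  RowInv r v w h l = l ≡ v → BeyondRow r w h

  ColInv : ℕ → ℕ → Wire → ℕ → ℕ → Set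
  ColInv c v w h l = l ≡ v → BeyondCol c w h

  -- Confinement comes from the wiring: at cell (x, y) the tracked chip either stays on a row from r
  -- on or goes down a column that has then passed row r.
  RowInv-preserved : ∀ r v → Preserved (RowInv r v)
  RowInv-preserved r v _ _ _ (inj₁ (p , q)) = (λ e → <⇒≤ (q e)) , (λ e → s≤s (p e))
  RowInv-preserved r v _ _ _ (inj₂ (p , q)) = p , (λ e → ≤-trans (q e) (n≤1+n _))

  ColInv-preserved : ∀ c v → Preserved (ColInv c v)
  ColInv-preserved c v _ _ _ (inj₁ (p , q)) = (λ e → s≤s (q e)) , (λ e → <⇒≤ (p e))
  ColInv-preserved c v _ _ _ (inj₂ (p , q)) = (λ e → ≤-trans (p e) (n≤1+n _)) , q

  beyond-row⇒≤ : ∀ {r v c F d} → r ≤ a → v ∈ oneTo N → State (RowInv r v) c F d → Stable c → ReadsAs c (oneTo N) →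
    v + r ≤ N
  beyond-row⇒≤ {r} {v} {c} {F} {d} r≤a v∈ s stable reads = bound (∈-map⁻ proj₂ (∈-resp-↭ (↭-sym (State.labels s)) v∈))
    where
    full : ∀ {x} → x ≤ a → F (row x) ≡ suc b
    full = stable⇒row-full s stable (<-wellFounded _)
    bound : (∃ λ wl → wl ∈ d × v ≡ proj₂ wl) → v + r ≤ N
    bound ((row x , _) , wl∈ , refl) = ≤-trans (+-monoʳ-≤ v (State.inv s wl∈ refl)) (row-label-≤ s full reads x wl∈)
    -- On a column, the chip is smaller than the one on row a, the last row, whose label is at most
    -- N - a.
    bound ((col y , _) , wl∈ , refl) = ≤-trans
      (+-mono-≤ (<⇒≤ (col-label<row-label s full reads wl∈ (proj₂ last-row))) r≤a) (row-label-≤ s full reads a (proj₂ last-row))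
      where last-row = valid⇒label s {row a} ≤-refl

  beyond-col⇒≥ : ∀ {r v c F d} → r ≤ b → v ∈ oneTo N → State (ColInv r v) c F d → Stable c → ReadsAs c (oneTo N) →
    suc r ≤ v
  beyond-col⇒≥ {r} {v} {c} {F} {d} r≤b v∈ s stable reads = bound (∈-map⁻ proj₂ (∈-resp-↭ (↭-sym (State.labels s)) v∈))
    where
    full : ∀ {x} → x ≤ a → F (row x) ≡ suc b
    full = stable⇒row-full s stable (<-wellFounded _)
    bound : (∃ λ wl → wl ∈ d × v ≡ proj₂ wl) → suc r ≤ v
    bound ((col y , _) , wl∈ , refl) = ≤-trans (s≤s (State.inv s wl∈ refl)) (col-label-≥ s full reads y wl∈)
    bound ((row x , _) , wl∈ , refl) = ≤-trans (s≤s r≤b) (≤-trans (col-label-≥ s full reads b (proj₂ last-col))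
      (<⇒≤ (col-label<row-label s full reads (proj₂ last-col) wl∈)))
      where last-col = valid⇒label s {col b} ≤-refl

  module _ {π : List ℕ} (perm : IsPerm (suc (a + b)) π) where

    row-start : ∀ {i x} → i ≤ a → (i , x) ∈ indexed 0 π → ∀ {j z} → (j , z) ∈ indexed 0 π →
      RowInv (a ∸ i) (suc x) (wireAt a j) 0 (relabel 1 z)
    row-start {i} {x} i≤a ix∈ {j} {z} jz∈ e = subst (λ w → BeyondRow (a ∸ i) w 0)
      (sym (trans (cong (wireAt a) (entry-unique perm (subst (λ z → (j , z) ∈ indexed 0 π) z≡x jz∈) ix∈)) (wireAt-≤ i≤a))) ≤-refl
      where
      z≡x : z ≡ x
      z≡x = suc-injective (trans (sym (relabel-1 (proj₁ (entry-value perm jz∈)))) e)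

    col-start : ∀ {i x} → ¬ i ≤ a → (i , x) ∈ indexed 0 π → ∀ {j z} → (j , z) ∈ indexed 0 π →
      ColInv (i ∸ a) x (wireAt a j) 0 (relabel N z)
    col-start {i} {x} i≰a ix∈ {j} {z} jz∈ e = subst (λ w → BeyondCol (i ∸ a) w 0)
      (sym (trans (cong (wireAt a) (entry-unique perm (subst (λ z → (j , z) ∈ indexed 0 π) z≡x jz∈) ix∈)) (wireAt-≰ i≰a))) ≤-refl
      where
      z≡x : z ≡ x
      z≡x = trans (sym (relabel-fix (s≤s (proj₂ (entry-value perm jz∈))))) e

    -- With r = 1 the entry x becomes the chip x + 1, the worst case for an upper bound, and it
    -- cannot leave row a - i towards earlier rows. An entry starting on a column satisfies the
    -- bound because x ≤ n.
    sorts-1⇒upper : Sorts 1 π → ∀ {i x} → (i , x) ∈ indexed 0 π → Dec (i ≤ a) → x ≤ suc i + b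
    sorts-1⇒upper _ {i} ix∈ (no i≰a) = ≤-trans (proj₂ (entry-value perm ix∈)) (s≤s (+-monoˡ-≤ b (≰⇒≥ i≰a)))
    sorts-1⇒upper (c , ms , stable , reads) {i} {x} ix∈ (yes i≤a) = +-cancelʳ-≤ (a ∸ i) x (suc i + b)
      (ℕ.s≤s⁻¹ (≤-trans (beyond-row⇒≤ (m∸n≤m a i) (∈-oneTo⁺ (s≤s z≤n) (s≤s (proj₂ (entry-value perm ix∈))))
        (proj₂ (proj₂ end)) stable reads) (≤-reflexive N≡)))
      where
      end = moves-state (RowInv-preserved (a ∸ i) (suc x)) (start-state perm {RowInv (a ∸ i) (suc x)} {1} ≤-refl (s≤s z≤n)
        (λ e → contradiction (suc-injective e) (<⇒≢ (proj₁ (entry-value perm ix∈)))) (row-start i≤a ix∈)) ms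
      N≡ : N ≡ suc (suc i + b + (a ∸ i))
      N≡ = cong (2 +_) (begin
        a + b             ≡⟨ cong (_+ b) (m+[n∸m]≡n i≤a) ⟨
        i + (a ∸ i) + b   ≡⟨ +-assoc i (a ∸ i) b ⟩
        i + ((a ∸ i) + b) ≡⟨ cong (i +_) (+-comm (a ∸ i) b) ⟩
        i + (b + (a ∸ i)) ≡⟨ +-assoc i b (a ∸ i) ⟨
        i + b + (a ∸ i)   ∎)
        where open ≡-Reasoning

    -- With r = N the labels of π are unchanged, the worst case for a lower bound. An entry with i ≤
    -- a satisfies it because x ≥ 1.
    sorts-N⇒lower : Sorts N π → ∀ {i x} → (i , x) ∈ indexed 0 π → Dec (i ≤ a) → suc i ≤ x + a
    sorts-N⇒lower _ ix∈ (yes i≤a) = +-mono-≤ (proj₁ (entry-value perm ix∈)) i≤a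
    sorts-N⇒lower (c , ms , stable , reads) {i} {x} ix∈ (no i≰a) = ≤-trans
      (≤-reflexive (cong suc (sym (m∸n+n≡m (≰⇒≥ i≰a)))))
      (+-monoˡ-≤ a (beyond-col⇒≥ (m≤n+o⇒m∸n≤o i a (entry-index perm ix∈))
        (∈-oneTo⁺ (proj₁ (entry-value perm ix∈)) (≤-trans (proj₂ (entry-value perm ix∈)) (n≤1+n _)))
        (proj₂ (proj₂ end)) stable reads))
      where
      end = moves-state (ColInv-preserved (i ∸ a) x) (start-state perm {ColInv (i ∸ a) x} {N} (s≤s z≤n) ≤-refl
        (λ e → contradiction (sym e) (<⇒≢ (s≤s (proj₂ (entry-value perm ix∈))))) (col-start i≰a ix∈)) ms

    -- The two extreme insertions decide everything: together with `in-band⇒sorts`, sorting for r =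
    -- 1 and r = N already gives sorting for every r.
    sorts⇒in-band : (∀ r → 1 ≤ r → r ≤ N → Sorts r π) → All (InBand a b) (indexed 0 π)
    sorts⇒in-band sorts = All.tabulate λ ix∈ →
      sorts-1⇒upper (sorts 1 ≤-refl (s≤s z≤n)) ix∈ (_ ℕ.≤? a) , sorts-N⇒lower (sorts N (s≤s z≤n) ≤-refl) ix∈ (_ ℕ.≤? a)

module _ {a b n : ℕ} (n≡ : n ≡ suc (a + b)) (a≡ : ⌊ (n ∸ 1) /2⌋ ≡ a) where

  RToppleable≡Sorts : ∀ π r → RToppleable n π r ≡ Grid.Sorts a b r π
  RToppleable≡Sorts π r = cong₂ (λ h m → ∃ λ c → Star Move ((ℤ.+ 0 , r) ∷ place r (ℤ.- (ℤ.+ h)) π) c × Stable c × ReadsAs c (oneTo (suc m))) a≡ n≡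

  toppleable⇒in-band : ∀ {π} → Toppleable n π → IsPerm n π × All (InBand a b) (indexed 0 π)
  toppleable⇒in-band {π} (perm , sorts) = perm , Grid.sorts⇒in-band a b (subst (λ m → IsPerm m π) n≡ perm)
    (λ r 1≤r r≤ → subst id (RToppleable≡Sorts π r) (sorts r 1≤r (subst (λ m → r ≤ suc m) (sym n≡) r≤)))

  in-band⇒toppleable : ∀ {π} → IsPerm n π × All (InBand a b) (indexed 0 π) → Toppleable n π
  in-band⇒toppleable {π} (perm , band) = perm , λ r 1≤r r≤ → subst id (sym (RToppleable≡Sorts π r))
    (Grid.in-band⇒sorts a b (subst (λ m → IsPerm m π) n≡ perm) 1≤r (subst (λ m → r ≤ suc m) n≡ r≤) band)

-- Permanents

module _ {A : Set} where

  -- The index set of a row expansion: `g` sees each column in turn together with the columns that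
  -- remain.
  pickConcat : {B : Set} → (A → List A → List B) → List A → List B
  pickConcat g []       = []
  pickConcat g (x ∷ xs) = g x xs ++ pickConcat (λ c rest → g c (x ∷ rest)) xs

  pickSum : (A → List A → ℕ) → List A → ℕ
  pickSum g []       = 0
  pickSum g (x ∷ xs) = g x xs + pickSum (λ c rest → g c (x ∷ rest)) xs

  words : List (A → Bool) → List A → List (List A)
  words []       []      = [] ∷ []
  words []       (_ ∷ _) = []
  words (r ∷ rs) cs      = pickConcat (λ c rest → if r c then map (c ∷_) (words rs rest) else []) cs

  -- The permanent of the 0-1 matrix with rows rs and columns cs.
  per : List (A → Bool) → List A → ℕ
  per []       []      = 1
  per []       (_ ∷ _) = 0
  per (r ∷ rs) cs      = pickSum (λ c rest → if r c then per rs rest else 0) cs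

  Fits : List (A → Bool) → List A → Set
  Fits = Pointwise (λ r c → r c ≡ true)

  swap-picked : ∀ {c x : A} {rest xs} → c ∷ rest ↭ xs → c ∷ x ∷ rest ↭ x ∷ xs
  swap-picked p = ↭-trans (swap _ _ ↭-refl) (prep _ p)

  pickSum-cong : ∀ {g h : A → List A → ℕ} xs → (∀ {c rest} → c ∷ rest ↭ xs → g c rest ≡ h c rest) →
    pickSum g xs ≡ pickSum h xs
  pickSum-cong []       g≗h = refl
  pickSum-cong (x ∷ xs) g≗h = cong₂ _+_ (g≗h ↭-refl) (pickSum-cong xs (λ p → g≗h (swap-picked p)))

  pickSum-const : ∀ {g : A → List A → ℕ} {k} xs → (∀ {c rest} → c ∷ rest ↭ xs → g c rest ≡ k) →
    pickSum g xs ≡ length xs * k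
  pickSum-const []       g≗k = refl
  pickSum-const (x ∷ xs) g≗k = cong₂ _+_ (g≗k ↭-refl) (pickSum-const xs (λ p → g≗k (swap-picked p)))

  pickSum-0 : ∀ {g : A → List A → ℕ} xs → (∀ {c rest} → c ∷ rest ↭ xs → g c rest ≡ 0) → pickSum g xs ≡ 0
  pickSum-0 xs g≗0 = trans (pickSum-const xs g≗0) (*-zeroʳ (length xs))

  pickSum-++ : ∀ (g : A → List A → ℕ) xs ys →
    pickSum g (xs ++ ys) ≡ pickSum (λ c rest → g c (rest ++ ys)) xs + pickSum (λ c rest → g c (xs ++ rest)) ys
  pickSum-++ g []       ys = refl
  pickSum-++ g (x ∷ xs) ys = trans (cong (g x (xs ++ ys) +_) (pickSum-++ (λ c rest → g c (x ∷ rest)) xs ys))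
    (sym (+-assoc (g x (xs ++ ys)) _ _))

  pickSum-++₃ : ∀ (g : A → List A → ℕ) xs ys zs → pickSum g (xs ++ (ys ++ zs)) ≡
    pickSum (λ c rest → g c (rest ++ (ys ++ zs))) xs +
    (pickSum (λ c rest → g c (xs ++ (rest ++ zs))) ys + pickSum (λ c rest → g c (xs ++ (ys ++ rest))) zs)
  pickSum-++₃ g xs ys zs = trans (pickSum-++ g xs (ys ++ zs))
    (cong (pickSum (λ c rest → g c (rest ++ (ys ++ zs))) xs +_) (pickSum-++ (λ c rest → g c (xs ++ rest)) ys zs))

  pickSum-+ : ∀ (g h : A → List A → ℕ) xs → pickSum (λ c rest → g c rest + h c rest) xs ≡ pickSum g xs + pickSum h xs
  pickSum-+ g h []       = refl
  pickSum-+ g h (x ∷ xs) = trans (cong (g x xs + h x xs +_) (pickSum-+ (λ c r → g c (x ∷ r)) (λ c r → h c (x ∷ r)) xs))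
    (solve 4 (λ p q r s → (p :+ q) :+ (r :+ s) := (p :+ r) :+ (q :+ s)) refl (g x xs) (h x xs) _ _)
    where open +-*-Solver

  -- Both sides run over ordered pairs of distinct columns. This is what makes two rows of a
  -- permanent interchangeable.
  pickSum-swap : ∀ (h : A → A → List A → ℕ) xs →
    pickSum (λ c rest → pickSum (h c) rest) xs ≡ pickSum (λ c rest → pickSum (λ c' → h c' c) rest) xs
  pickSum-swap h []       = refl
  pickSum-swap h (x ∷ xs) = begin
    s + pickSum (λ c rest → h c x rest + pickSum (λ c' r → h c c' (x ∷ r)) rest) xs
      ≡⟨ cong (s +_) (pickSum-+ _ _ xs) ⟩
    s + (t + pickSum (λ c rest → pickSum (λ c' r → h c c' (x ∷ r)) rest) xs)
      ≡⟨ cong (λ z → s + (t + z)) (pickSum-swap (λ c c' r → h c c' (x ∷ r)) xs) ⟩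
    s + (t + u)
      ≡⟨ solve 3 (λ s t u → s :+ (t :+ u) := t :+ (s :+ u)) refl s t u ⟩
    t + (s + u)
      ≡⟨ cong (t +_) (pickSum-+ _ _ xs) ⟨
    t + pickSum (λ c rest → h x c rest + pickSum (λ c' r → h c' c (x ∷ r)) rest) xs
      ∎
    where
    open ≡-Reasoning
    open +-*-Solver
    s = pickSum (h x) xs
    t = pickSum (λ c → h c x) xs
    u = pickSum (λ c rest → pickSum (λ c' r → h c' c (x ∷ r)) rest) xs

  pickSum-↭ : ∀ {g : A → List A → ℕ} {xs ys} → (∀ c {r r'} → r ↭ r' → g c r ≡ g c r') → xs ↭ ys →
    pickSum g xs ≡ pickSum g ys
  pickSum-↭ resp ↭.refl     = refl
  pickSum-↭ resp (prep x p) = cong₂ _+_ (resp x p) (pickSum-↭ (λ c q → resp c (prep x q)) p)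
  pickSum-↭ {g} {x ∷ y ∷ xs} {_ ∷ _ ∷ ys} resp (swap x y p) = begin
    g x (y ∷ xs) + (g y (x ∷ xs) + pickSum (λ c r → g c (x ∷ y ∷ r)) xs)
      ≡⟨ cong₂ _+_ (resp x (prep y p)) (cong₂ _+_ (resp y (prep x p))
           (trans (pickSum-↭ (λ c q → resp c (prep x (prep y q))) p) (pickSum-cong ys (λ _ → resp _ (swap x y ↭-refl))))) ⟩
    g x (y ∷ ys) + (g y (x ∷ ys) + s)
      ≡⟨ solve 3 (λ p q r → p :+ (q :+ r) := q :+ (p :+ r)) refl (g x (y ∷ ys)) (g y (x ∷ ys)) s ⟩
    g y (x ∷ ys) + (g x (y ∷ ys) + s)
      ∎
    where
    open ≡-Reasoning
    open +-*-Solver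
    s = pickSum (λ c r → g c (y ∷ x ∷ r)) ys
  pickSum-↭ resp (↭.trans p q) = trans (pickSum-↭ resp p) (pickSum-↭ resp q)

  per-cols-↭ : ∀ rs {cs cs' : List A} → cs ↭ cs' → per rs cs ≡ per rs cs'
  per-cols-↭ [] {[]} p with ↭-empty-inv (↭-sym p)
  ... | refl = refl
  per-cols-↭ [] {_ ∷ _} {[]}    p = contradiction p ¬x∷xs↭[]
  per-cols-↭ [] {_ ∷ _} {_ ∷ _} p = refl
  per-cols-↭ (r ∷ rs) p = pickSum-↭ (λ c q → cong (if r c then_else 0) (per-cols-↭ rs q)) p

  per-row-cong : ∀ (r : A → Bool) rs rs' cs → (∀ cs → per rs cs ≡ per rs' cs) → per (r ∷ rs) cs ≡ per (r ∷ rs') cs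
  per-row-cong r rs rs' cs eq = pickSum-cong cs (λ {c} {rest} _ → cong (if r c then_else 0) (eq rest))

  if-pickSum : ∀ (b : Bool) (g : A → List A → ℕ) xs →
    (if b then pickSum g xs else 0) ≡ pickSum (λ c rest → if b then g c rest else 0) xs
  if-pickSum true  g xs = refl
  if-pickSum false g xs = sym (pickSum-0 xs (λ _ → refl))

  if-swap : ∀ (b c : Bool) (n : ℕ) → (if b then (if c then n else 0) else 0) ≡ (if c then (if b then n else 0) else 0)
  if-swap true  true  n = refl
  if-swap true  false n = refl
  if-swap false true  n = refl
  if-swap false false n = refl

  per-rows-swap : ∀ (r s : A → Bool) rs cs → per (r ∷ s ∷ rs) cs ≡ per (s ∷ r ∷ rs) cs
  per-rows-swap r s rs cs = begin
    per (r ∷ s ∷ rs) cs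
      ≡⟨ pickSum-cong cs (λ {c} {rest} _ → if-pickSum (r c) _ rest) ⟩
    pickSum (λ c rest → pickSum (λ c' rest' → if r c then (if s c' then per rs rest' else 0) else 0) rest) cs
      ≡⟨ pickSum-swap (λ c c' rest' → if r c then (if s c' then per rs rest' else 0) else 0) cs ⟩
    pickSum (λ c rest → pickSum (λ c' rest' → if r c' then (if s c then per rs rest' else 0) else 0) rest) cs
      ≡⟨ pickSum-cong cs (λ {c} {rest} _ → pickSum-cong rest (λ {c'} _ → if-swap (r c') (s c) _)) ⟩
    pickSum (λ c rest → pickSum (λ c' rest' → if s c then (if r c' then per rs rest' else 0) else 0) rest) cs
      ≡⟨ pickSum-cong cs (λ {c} {rest} _ → if-pickSum (s c) _ rest) ⟨
    per (s ∷ r ∷ rs) cs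
      ∎
    where open ≡-Reasoning

  per-rows-↭ : ∀ {rs rs' : List (A → Bool)} → rs ↭ rs' → ∀ cs → per rs cs ≡ per rs' cs
  per-rows-↭ ↭.refl       cs = refl
  per-rows-↭ (prep {rs} {rs'} r p) cs = per-row-cong r rs rs' cs (per-rows-↭ p)
  per-rows-↭ (swap {rs} {rs'} r s p) cs = trans (per-rows-swap r s rs cs)
    (per-row-cong s (r ∷ rs) (r ∷ rs') cs (λ cs → per-row-cong r rs rs' cs (per-rows-↭ p)))
  per-rows-↭ (↭.trans p q)  cs = trans (per-rows-↭ p cs) (per-rows-↭ q cs)

  per-cong : ∀ {rs rs' : List (A → Bool)} {cs} → Pointwise (λ r r' → ∀ c → c ∈ cs → r c ≡ r' c) rs rs' →
    per rs cs ≡ per rs' cs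
  per-cong {cs = cs} [] = refl
  per-cong {r ∷ rs} {r' ∷ rs'} {cs} (r≗ ∷ rs≗) = pickSum-cong cs λ {c} {rest} p →
    cong₂ (if_then_else 0) (r≗ c (∈-resp-↭ p (here refl)))
      (per-cong (Pointwise.map (λ eq d d∈ → eq d (∈-resp-↭ p (there d∈))) rs≗))

  per-allowed : ∀ {s : A → Bool} m {cs} → length cs ≡ m → All (λ c → s c ≡ true) cs → per (replicate m s) cs ≡ m !
  per-allowed zero    {[]}    refl [] = refl
  per-allowed {s} (suc m) {cs} len all = trans (pickSum-const cs eq) (cong (_* m !) len)
    where
    eq : ∀ {c rest} → c ∷ rest ↭ cs → (if s c then per (replicate m s) rest else 0) ≡ m !
    eq p with All-resp-↭ (↭-sym p) all
    ... | sc ∷ all' rewrite sc = per-allowed m (suc-injective (trans (↭-length p) len)) all'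

  -- The column c survives every expansion step and is left over when the rows run out, where the
  -- permanent is 0.
  per-blocked : ∀ {s : A → Bool} m {cs c} → c ∈ cs → s c ≡ false → per (replicate m s) cs ≡ 0
  per-blocked zero    {_ ∷ _} _ _ = refl
  per-blocked {s} (suc m) {cs} {c} c∈ sc = pickSum-0 cs eq
    where
    eq : ∀ {d rest} → d ∷ rest ↭ cs → (if s d then per (replicate m s) rest else 0) ≡ 0
    eq {d} p with s d in sd
    ... | false = refl
    ... | true with ∈-resp-↭ (↭-sym p) c∈
    ... | here refl = contradiction (trans (sym sd) sc) λ ()
    ... | there c∈' = per-blocked m c∈' sc

  length-pickConcat : ∀ {B : Set} (g : A → List A → List B) xs → length (pickConcat g xs) ≡ pickSum (λ c r → length (g c r)) xs
  length-pickConcat g []       = refl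
  length-pickConcat g (x ∷ xs) = trans (length-++ (g x xs)) (cong (length (g x xs) +_) (length-pickConcat _ xs))

  ∈-pickConcat⁻ : ∀ {B : Set} {g : A → List A → List B} xs {z} → z ∈ pickConcat g xs →
    ∃ λ c → ∃ λ rest → c ∷ rest ↭ xs × z ∈ g c rest
  ∈-pickConcat⁻ {g = g} (x ∷ xs) z∈ with ∈-++⁻ (g x xs) z∈
  ... | inj₁ z∈g = x , xs , ↭-refl , z∈g
  ... | inj₂ z∈' with ∈-pickConcat⁻ xs z∈'
  ... | c , rest , p , z∈g = c , x ∷ rest , swap-picked p , z∈g

  ∈-pickConcat⁺ : ∀ {B : Set} (g : A → List A → List B) {xs c z} → c ∈ xs →
    (∀ {rest} → c ∷ rest ↭ xs → z ∈ g c rest) → z ∈ pickConcat g xs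
  ∈-pickConcat⁺ g (here refl) z∈ = ∈-++⁺ˡ (z∈ ↭-refl)
  ∈-pickConcat⁺ g {x ∷ xs} (there c∈) z∈ = ∈-++⁺ʳ (g x xs) (∈-pickConcat⁺ _ c∈ (λ p → z∈ (swap-picked p)))

  pickConcat-unique : ∀ {B : Set} {tag : B → Maybe A} {g : A → List A → List B} {xs} → Unique xs →
    (∀ {c rest} → c ∷ rest ↭ xs → Unique (g c rest)) → (∀ {c rest z} → z ∈ g c rest → tag z ≡ just c) →
    Unique (pickConcat g xs)
  pickConcat-unique {xs = []}     _          _  _     = []
  pickConcat-unique {xs = x ∷ xs} (x∉ ∷ uxs) ug tagged = Uniqueₚ.++⁺ (ug ↭-refl)
    (pickConcat-unique uxs (λ p → ug (swap-picked p)) tagged) disjoint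
    where
    disjoint : ∀ {z} → ¬ (z ∈ _ × z ∈ _)
    disjoint (z∈ , z∈') with ∈-pickConcat⁻ xs z∈'
    ... | c , rest , p , z∈g = All.lookup x∉ (∈-resp-↭ p (here refl)) (just-injective (trans (sym (tagged z∈)) (tagged z∈g)))

  ∈-words⁻ : ∀ rs {cs w} → w ∈ words rs cs → w ↭ cs × Fits rs w
  ∈-words⁻ []       {[]} (here refl) = ↭-refl , []
  ∈-words⁻ (r ∷ rs) {cs} w∈ with ∈-pickConcat⁻ cs w∈
  ... | c , rest , p , w∈' with r c in rc
  ... | true with ∈-map⁻ (c ∷_) w∈'
  ... | w' , w'∈ , refl with ∈-words⁻ rs w'∈
  ... | q , fits = ↭-trans (prep c q) p , rc ∷ fits

  ∈-words⁺ : ∀ {rs cs w} → w ↭ cs → Fits rs w → w ∈ words rs cs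
  ∈-words⁺ {cs = cs} p [] with ↭-empty-inv (↭-sym p)
  ... | refl = here refl
  ∈-words⁺ {r ∷ rs} {cs} {c ∷ w} p (rc ∷ fits) = ∈-pickConcat⁺ _ (∈-resp-↭ p (here refl)) found
    where
    found : ∀ {rest} → c ∷ rest ↭ cs → c ∷ w ∈ (if r c then map (c ∷_) (words rs rest) else [])
    found q rewrite rc = ∈-map⁺ (c ∷_) (∈-words⁺ (drop-∷ (↭-trans p (↭-sym q))) fits)

  words-unique : ∀ rs {cs : List A} → Unique cs → Unique (words rs cs)
  words-unique []       {[]}    _ = [] ∷ []
  words-unique []       {_ ∷ _} _ = []
  words-unique (r ∷ rs) {cs} ucs = pickConcat-unique {tag = head} ucs blocks tagged
    where
    blocks : ∀ {c rest} → c ∷ rest ↭ cs → Unique (if r c then map (c ∷_) (words rs rest) else [])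
    blocks {c} p with r c | Unique-resp-↭ (↭-sym p) ucs
    ... | true  | _ ∷ u = Uniqueₚ.map⁺ (λ { refl → refl }) (words-unique rs u)
    ... | false | _     = []
    tagged : ∀ {c rest z} → z ∈ (if r c then map (c ∷_) (words rs rest) else []) → head z ≡ just c
    tagged {c} z∈ with r c
    ... | true with ∈-map⁻ (c ∷_) z∈
    ... | _ , _ , refl = refl

  length-words : ∀ rs (cs : List A) → length (words rs cs) ≡ per rs cs
  length-words []       []      = refl
  length-words []       (_ ∷ _) = refl
  length-words (r ∷ rs) cs = trans (length-pickConcat _ cs) (pickSum-cong cs λ {c} {rest} _ → eq c rest)
    where
    eq : ∀ c rest → length (if r c then map (c ∷_) (words rs rest) else []) ≡ (if r c then per rs rest else 0)
    eq c rest with r c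
    ... | true  = trans (length-map (c ∷_) (words rs rest)) (length-words rs rest)
    ... | false = refl

-- The number of maps from a q-set to an (e + f + 1)-set that hit e given elements.
cover : ℕ → ℕ → ℕ → ℕ
cover e       f (suc q) = suc f * cover e f q + e * cover (pred e) (suc f) q
cover zero    f zero    = 1
cover (suc e) f zero    = 0

-- `k` rows are still to come, `m` is the current count, and `w` is the weight of the count reached
-- at the end.
iter : ℕ → (ℕ → ℕ) → ℕ → ℕ
iter zero    w m = w m
iter (suc k) w m = m * iter k w m + iter k w (suc m)

-- This also counts the orderings of strict chains of m nonempty subsets of a q-set: send each
-- element to the step at which it enters the chain, or to 0 if it never does. Strictness means that
-- the steps 1, ..., m are all hit.
chains : ℕ → ℕ → ℕ
chains q m = m ! * cover m 0 q

≤ᵇ-true : ∀ {m n} → m ≤ n → (m ≤ᵇ n) ≡ true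
≤ᵇ-true {m} {n} m≤n with m ≤ᵇ n | ≤⇒≤ᵇ m≤n
... | true | _ = refl

≤ᵇ-false : ∀ {m n} → n < m → (m ≤ᵇ n) ≡ false
≤ᵇ-false {m} {n} n<m with m ≤ᵇ n | ≤ᵇ⇒≤ m n
... | false | _   = refl
... | true  | m≤n = contradiction (m≤n _) (<⇒≱ n<m)

≤ᵇ-suc : ∀ m n → (m ≤ᵇ n) ≡ (suc m ≤ᵇ suc n)
≤ᵇ-suc zero    n = refl
≤ᵇ-suc (suc m) n = refl

true-≤ᵇ : ∀ {m n} → (m ≤ᵇ n) ≡ true → m ≤ n
true-≤ᵇ {m} {n} eq with m ≤ᵇ n | ≤ᵇ⇒≤ m n
... | true | m≤n = m≤n _

below : ℕ → ℕ → Bool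
below j c = suc j ≤ᵇ c

lower : ℕ → List (ℕ → Bool)
lower j = map below (downFrom j)

-- Expanding the permanent of the band matrix

module Staircase (q : ℕ) where

  small : ℕ → Bool
  small c = c ≤ᵇ q

  upperRow : ℕ → ℕ → Bool
  upperRow i c = suc c ≤ᵇ i + suc q

  down : ℕ → List ℕ
  down j = map suc (downFrom j)

  ∈-down⁻ : ∀ j {c} → c ∈ down j → c ≤ j
  ∈-down⁻ (suc j) (here refl) = ≤-refl
  ∈-down⁻ (suc j) (there c∈)  = ≤-trans (∈-down⁻ j c∈) (n≤1+n j)

  if-true : ∀ {b} {m n : ℕ} → b ≡ true → m ≡ n → (if b then m else 0) ≡ n
  if-true refl eq = eq

  if-false : ∀ {b} {m : ℕ} → b ≡ false → (if b then m else 0) ≡ 0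
  if-false refl = refl

  -- L: columns beyond q, A: columns at most q open to all remaining lower rows.
  per-lower : ∀ j e f L A → j ≤ q → length L ≡ e → length A ≡ f →
    All (q <_) L → All (λ c → j < c × c ≤ q) A →
    per (lower j ++ replicate (e + f) small) (L ++ (A ++ down j)) ≡ (e + f) ! * cover e f j
  per-lower zero zero f [] A j≤q lenL lenA _ allA = begin
    per (replicate f small) (A ++ []) ≡⟨ cong (per (replicate f small)) (++-identityʳ A) ⟩
    per (replicate f small) A         ≡⟨ per-allowed f lenA (All.map (λ p → ≤ᵇ-true (proj₂ p)) allA) ⟩
    f !                               ≡⟨ *-identityʳ (f !) ⟨
    f ! * 1                           ∎
    where open ≡-Reasoning
  -- A column beyond q that no lower row took is left to the `small` rows, which reject it.
  per-lower zero (suc e) f (c ∷ L) A j≤q lenL lenA (q<c ∷ _) allA =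
    trans (per-blocked {s = small} (suc e + f) {(c ∷ L) ++ (A ++ [])} (here refl) (≤ᵇ-false q<c)) (sym (*-zeroʳ ((suc e + f) !)))
  per-lower (suc j) e f L A j<q lenL lenA allL allA = begin
    per (lower (suc j) ++ S) (L ++ (A ++ suc j ∷ down j))
      ≡⟨ per-cols-↭ (lower (suc j) ++ S) (++⁺ˡ L (shift (suc j) A (down j))) ⟩
    pickSum g (L ++ (A' ++ down j))
      ≡⟨ trans (pickSum-++₃ g L A' (down j))
           (cong₂ _+_ (pickSum-const L from-L) (cong₂ _+_ (pickSum-const A' from-A) (pickSum-0 (down j) from-down))) ⟩
    length L * K₁ + (length A' * K₂ + 0)
      ≡⟨ cong₂ (λ x y → x * K₁ + (suc y * K₂ + 0)) lenL lenA ⟩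
    e * ((e + f) ! * cover (pred e) (suc f) j) + (suc f * ((e + f) ! * cover e f j) + 0)
      ≡⟨ solve 5 (λ e n x f y → e :* (n :* x) :+ (f :* (n :* y) :+ con 0) := n :* (f :* y :+ e :* x)) refl
           e ((e + f) !) (cover (pred e) (suc f) j) (suc f) (cover e f j) ⟩
    (e + f) ! * (suc f * cover e f j + e * cover (pred e) (suc f) j)
      ∎
    where
    open ≡-Reasoning
    open +-*-Solver
    S = replicate (e + f) small
    A' = suc j ∷ A
    g = λ c rest → if below j c then per (lower j ++ S) rest else 0
    K₁ = (e + f) ! * cover (pred e) (suc f) j
    K₂ = (e + f) ! * cover e f j
    j≤q = ≤-trans (n≤1+n j) j<q
    allA' : All (λ c → j < c × c ≤ q) A'
    allA' = (≤-refl , j<q) ∷ All.map (λ { (p , r) → ≤-trans (n≤1+n _) p , r }) allA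
    -- A column beyond q is consumed, while `suc j`, which this row passes over, becomes open to all
    -- later rows: e falls, f rises, and the number e + f of postponed rows is unchanged.
    from-L : ∀ {c rest} → c ∷ rest ↭ L → g c (rest ++ (A' ++ down j)) ≡ K₁
    from-L {c} {rest} p with All-resp-↭ (↭-sym p) allL | trans (sym lenL) (sym (↭-length p))
    ... | q<c ∷ allR | refl = if-true (≤ᵇ-true (≤-trans j<q (<⇒≤ q<c)))
          (subst (λ m → per (lower j ++ replicate m small) (rest ++ (A' ++ down j)) ≡ m ! * cover (length rest) (suc f) j)
            (+-suc (length rest) f)
            (per-lower j (length rest) (suc f) rest A' j≤q refl (cong suc lenA) allR allA'))
    from-A : ∀ {c rest} → c ∷ rest ↭ A' → g c (L ++ (rest ++ down j)) ≡ K₂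
    from-A {c} {rest} p with All-resp-↭ (↭-sym p) allA'
    ... | (j<c , _) ∷ allR = if-true (≤ᵇ-true j<c)
          (per-lower j e f L rest j≤q lenL (trans (suc-injective (↭-length p)) lenA) allL allR)
    from-down : ∀ {c rest} → c ∷ rest ↭ down j → g c (L ++ (A' ++ rest)) ≡ 0
    from-down p = if-false (≤ᵇ-false (s≤s (∈-down⁻ j (∈-resp-↭ p (here refl)))))

  -- L: the columns beyond q open to all remaining upper rows.
  per-upper : ∀ k i m L → length L ≡ m → All (λ c → q < c × c < i + suc q) L →
    per (map upperRow (range i k) ++ (lower q ++ replicate m small)) (L ++ (range (i + suc q) k ++ down q)) ≡ iter k (chains q) m
  per-upper zero i m L lenL allL = subst (λ h → per (lower q ++ replicate h small) (L ++ down q) ≡ h ! * cover m 0 q)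
    (+-identityʳ m) (per-lower q m 0 L [] ≤-refl lenL refl (All.map proj₁ allL) [])
  per-upper (suc k) i m L lenL allL = begin
    pickSum g (L ++ (F ++ down q))
      ≡⟨ trans (pickSum-++₃ g L F (down q))
           (cong₂ _+_ (pickSum-const L from-L) (cong₂ _+_ (pickSum-0 F from-F) (pickSum-cong (down q) from-down))) ⟩
    length L * iter k (chains q) m + pickSum (λ c rest → h c (L ++ (F ++ rest))) (down q)
      ≡⟨ cong₂ (λ l r → l * iter k (chains q) m + r) lenL (sym deferred-sum) ⟩
    m * iter k (chains q) m + per (small ∷ R) (L ++ (F ++ down q))
      ≡⟨ cong (m * iter k (chains q) m +_) (trans (per-rows-↭ rows-↭ (L ++ (F ++ down q)))
           (per-cols-↭ (map upperRow (range (suc i) k) ++ (lower q ++ replicate (suc m) small)) (shift (i + suc q) L (range (suc i + suc q) k ++ down q)))) ⟩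
    m * iter k (chains q) m + per (map upperRow (range (suc i) k) ++ (lower q ++ replicate (suc m) small))
                                  ((i + suc q) ∷ L ++ (range (suc i + suc q) k ++ down q))
      ≡⟨ cong (m * iter k (chains q) m +_) (per-upper k (suc i) (suc m) (i + suc q ∷ L) (cong suc lenL) (new ∷ older allL)) ⟩
    m * iter k (chains q) m + iter k (chains q) (suc m)
      ∎
    where
    open ≡-Reasoning
    R = map upperRow (range (suc i) k) ++ (lower q ++ replicate m small)
    F = range (i + suc q) (suc k)
    g = λ c rest → if upperRow i c then per R rest else 0
    h = λ c rest → if small c then per R rest else 0
    new : q < i + suc q × i + suc q < suc i + suc q
    new = m≤n+m (suc q) i , ≤-refl
    older : ∀ {L} → All (λ c → q < c × c < i + suc q) L → All (λ c → q < c × c < suc i + suc q) L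
    older = All.map λ { (p , r) → p , ≤-trans r (n≤1+n _) }
    rows-↭ : small ∷ R ↭ map upperRow (range (suc i) k) ++ (lower q ++ replicate (suc m) small)
    rows-↭ = ↭-sym (↭-trans (++⁺ˡ (map upperRow (range (suc i) k)) (shift small (lower q) (replicate m small)))
                            (shift small (map upperRow (range (suc i) k)) _))
    -- The column taken from `L` is replaced by `i + suc q`, which row i rejects and row i + 1
    -- accepts, so m is unchanged.
    from-L : ∀ {c rest} → c ∷ rest ↭ L → g c (rest ++ (F ++ down q)) ≡ iter k (chains q) m
    from-L {c} {rest} p with All-resp-↭ (↭-sym p) allL
    ... | (_ , c<) ∷ allR = if-true (≤ᵇ-true c<) (trans (per-cols-↭ R (shift (i + suc q) rest (range (suc i + suc q) k ++ down q)))
          (per-upper k (suc i) m (i + suc q ∷ rest) (trans (↭-length p) lenL) (new ∷ older allR)))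
    F-large : ∀ {c rest} → c ∷ rest ↭ F → i + suc q ≤ c
    F-large p = proj₁ (∈-range⁻ (i + suc q) (suc k) (∈-resp-↭ p (here refl)))
    from-F : ∀ {c rest} → c ∷ rest ↭ F → g c (L ++ (rest ++ down q)) ≡ 0
    from-F p = if-false (≤ᵇ-false (s≤s (F-large p)))
    down-small : ∀ {c rest} → c ∷ rest ↭ down q → c ≤ q
    down-small p = ∈-down⁻ q (∈-resp-↭ p (here refl))
    from-down : ∀ {c rest} → c ∷ rest ↭ down q → g c (L ++ (F ++ rest)) ≡ h c (L ++ (F ++ rest))
    from-down {c} p = trans (if-true (≤ᵇ-true (≤-trans (s≤s (down-small p)) (m≤n+m (suc q) i))) refl)
      (sym (if-true (≤ᵇ-true (down-small p)) refl))
    -- A choice among the columns up to q is the same for row i as for a `small` row. The row can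
    -- therefore be postponed behind the lower rows, and the newly opened column makes m + 1.
    deferred-sum : per (small ∷ R) (L ++ (F ++ down q)) ≡ pickSum (λ c rest → h c (L ++ (F ++ rest))) (down q)
    deferred-sum = trans (pickSum-++₃ h L F (down q)) (cong₂ _+_
      (pickSum-0 L (λ p → if-false (≤ᵇ-false (proj₁ (All.lookup allL (∈-resp-↭ p (here refl)))))))
      (cong (_+ pickSum (λ c rest → h c (L ++ (F ++ rest))) (down q))
        (pickSum-0 F h-from-F)))
      where
      h-from-F : ∀ {c rest} → c ∷ rest ↭ F → h c (L ++ (rest ++ down q)) ≡ 0
      h-from-F p = if-false (≤ᵇ-false (≤-trans (m≤n+m (suc q) i) (F-large p)))

-- The number of permutations in the band

module BandCount (a b : ℕ) where
  open Staircase (suc b)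

  n : ℕ
  n = suc (a + b)

  bandRow : ℕ → ℕ → Bool
  bandRow i c = (c ≤ᵇ suc i + b) ∧ (suc i ≤ᵇ c + a)

  bandRows : List (ℕ → Bool)
  bandRows = map bandRow (range 0 n)

  fits⇒in-band : ∀ i k {w} → Fits (map bandRow (range i k)) w → All (InBand a b) (indexed i w)
  fits⇒in-band i zero    []       = []
  fits⇒in-band i (suc k) {c ∷ w} (fit ∷ fits) = inBand ∷ fits⇒in-band (suc i) k fits
    where
    inBand : InBand a b (i , c)
    inBand with c ≤ᵇ suc i + b in p | suc i ≤ᵇ c + a in q
    ... | true | true = true-≤ᵇ p , true-≤ᵇ q

  in-band⇒fits : ∀ i w → All (InBand a b) (indexed i w) → Fits (map bandRow (range i (length w))) w
  in-band⇒fits i []      []              = []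
  in-band⇒fits i (c ∷ w) ((p , q) ∷ bands) = cong₂ _∧_ (≤ᵇ-true p) (≤ᵇ-true q) ∷ in-band⇒fits (suc i) w bands

  -- In the first a rows the lower inequality is automatic, since c ≥ 1.
  upper-agree : ∀ i k → i + k ≤ a → Pointwise (λ r r' → ∀ c → c ∈ oneTo n → r c ≡ r' c)
    (map bandRow (range i k)) (map upperRow (range i k))
  upper-agree i zero    _ = []
  upper-agree i (suc k) i+k≤a = agree ∷ upper-agree (suc i) k i+k<a
    where
    i+k<a = ≤-trans (≤-reflexive (sym (+-suc i k))) i+k≤a
    agree : ∀ c → c ∈ oneTo n → bandRow i c ≡ upperRow i c
    agree c c∈ = begin
      (c ≤ᵇ suc i + b) ∧ (suc i ≤ᵇ c + a) ≡⟨ cong ((c ≤ᵇ suc i + b) ∧_) (≤ᵇ-true (+-mono-≤ (proj₁ (∈-oneTo⁻ c∈)) (≤-trans (m≤m+n i k) (<⇒≤ i+k<a)))) ⟩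
      (c ≤ᵇ suc i + b) ∧ true             ≡⟨ Boolₚ.∧-identityʳ _ ⟩
      (c ≤ᵇ suc i + b)                    ≡⟨ ≤ᵇ-suc c (suc i + b) ⟩
      (suc c ≤ᵇ suc (suc i + b))          ≡⟨ cong (suc c ≤ᵇ_) (trans (cong suc (sym (+-suc i b))) (sym (+-suc i (suc b)))) ⟩
      upperRow i c                        ∎
      where open ≡-Reasoning

  -- From row a on the upper inequality is automatic, since c ≤ n.
  lower-agree : ∀ j k → Pointwise (λ r r' → ∀ c → c ∈ oneTo n → r c ≡ r' c)
    (map bandRow (range (j + a) k)) (map below (range j k))
  lower-agree j zero    = []
  lower-agree j (suc k) = agree ∷ lower-agree (suc j) k
    where
    agree : ∀ c → c ∈ oneTo n → bandRow (j + a) c ≡ below j c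
    agree c c∈ = cong₂ _∧_
      (≤ᵇ-true (≤-trans (proj₂ (∈-oneTo⁻ c∈)) (s≤s (+-monoˡ-≤ b (m≤n+m a j)))))
      shifted
      where
      shifted : (suc j + a ≤ᵇ c + a) ≡ (suc j ≤ᵇ c)
      shifted with suc j ≤? c
      ... | yes p = trans (≤ᵇ-true (+-monoˡ-≤ a p)) (sym (≤ᵇ-true p))
      ... | no ¬p = trans (≤ᵇ-false (+-monoˡ-< a (≰⇒> ¬p))) (sym (≤ᵇ-false (≰⇒> ¬p)))

  per-band : per bandRows (oneTo n) ≡ iter a (chains (suc b)) 0
  per-band = begin
    per bandRows (oneTo n)
      ≡⟨ cong (λ rs → per (map bandRow rs) (oneTo n)) (trans (cong (range 0) (sym (+-suc a b))) (range-++ 0 a (suc b))) ⟩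
    per (map bandRow (range 0 a ++ range (a + 0) (suc b))) (oneTo n)
      ≡⟨ cong (λ rs → per rs (oneTo n)) (trans (map-++ bandRow (range 0 a) (range (a + 0) (suc b)))
           (cong (λ h → map bandRow (range 0 a) ++ map bandRow (range h (suc b))) (+-identityʳ a))) ⟩
    per (map bandRow (range 0 a) ++ map bandRow (range (0 + a) (suc b))) (oneTo n)
      ≡⟨ per-cong (Pointwise.++⁺ (upper-agree 0 a ≤-refl) (lower-agree 0 (suc b))) ⟩
    per (map upperRow (range 0 a) ++ map below (range 0 (suc b))) (oneTo n)
      ≡⟨ per-rows-↭ (++⁺ˡ (map upperRow (range 0 a)) (map⁺ below lower-↭)) (oneTo n) ⟩
    per (map upperRow (range 0 a) ++ lower (suc b)) (oneTo n)
      ≡⟨ cong (λ rs → per (map upperRow (range 0 a) ++ rs) (oneTo n)) (sym (++-identityʳ (lower (suc b)))) ⟩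
    per (map upperRow (range 0 a) ++ (lower (suc b) ++ [])) (oneTo n)
      ≡⟨ per-cols-↭ (map upperRow (range 0 a) ++ (lower (suc b) ++ [])) columns-↭ ⟩
    per (map upperRow (range 0 a) ++ (lower (suc b) ++ [])) (range (suc (suc b)) a ++ down (suc b))
      -- Row 0 accepts exactly the columns up to b + 1, so no larger column is open and no row is
      -- postponed yet.
      ≡⟨ per-upper a 0 0 [] refl [] ⟩
    iter a (chains (suc b)) 0
      ∎
    where
    open ≡-Reasoning
    lower-↭ : range 0 (suc b) ↭ downFrom (suc b)
    lower-↭ = ↭-trans (↭-reflexive (sym (upTo-range (suc b)))) (↭-trans (↭-sym (↭-reverse (upTo (suc b)))) (↭-reflexive (reverse-upTo (suc b))))
    columns-↭ : oneTo n ↭ range (suc (suc b)) a ++ down (suc b)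
    columns-↭ = ↭-trans (↭-reflexive (trans (oneTo-range n) (trans (cong (range 1 ∘ suc) (+-comm a b))
      (trans (range-++ 1 (suc b) a) (cong (λ h → range 1 (suc b) ++ range h a) (+-comm (suc b) 1))))))
      (↭-trans (++-comm (range 1 (suc b)) (range (suc (suc b)) a))
        (++⁺ˡ (range (suc (suc b)) a) (↭-trans (↭-reflexive (sym (oneTo-range (suc b))))
          (map⁺ suc (↭-trans (↭-reflexive (upTo-range (suc b))) lower-↭)))))

  count-in-band : CountIs (λ π → IsPerm n π × All (InBand a b) (indexed 0 π)) (iter a (chains (suc b)) 0)
  count-in-band = words bandRows (oneTo n) , trans (length-words bandRows (oneTo n)) per-band ,
    words-unique bandRows (oneTo-unique n) , λ π → sound , complete
    where
    sound : ∀ {π} → π ∈ words bandRows (oneTo n) → IsPerm n π × All (InBand a b) (indexed 0 π)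
    sound π∈ with ∈-words⁻ bandRows π∈
    ... | perm , fits = perm , fits⇒in-band 0 n fits
    complete : ∀ {π} → IsPerm n π × All (InBand a b) (indexed 0 π) → π ∈ words bandRows (oneTo n)
    complete {π} (perm , bands) = ∈-words⁺ perm
      (subst (λ m → Fits (map bandRow (range 0 m)) π) (perm-length perm) (in-band⇒fits 0 π bands))

-- Symmetry of the count

iter-cong : ∀ {v w} k m → (∀ m → v m ≡ w m) → iter k v m ≡ iter k w m
iter-cong zero    m v≗w = v≗w m
iter-cong (suc k) m v≗w = cong₂ (λ x y → m * x + y) (iter-cong k m v≗w) (iter-cong k (suc m) v≗w)

-- The recursion can equally be peeled off at its last step, by absorbing that step into the weight.
iter-step : ∀ k w m → iter k (iter 1 w) m ≡ iter (suc k) w m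
iter-step zero    w m = refl
iter-step (suc k) w m = cong₂ (λ x y → m * x + y) (iter-step k w m) (iter-step k w (suc m))

-- Single out one of the optional values: either the map misses it, or it may be added to the values
-- that must be hit.
cover-split : ∀ e f q → cover e (suc f) q ≡ cover e f q + cover (suc e) f q
cover-split zero    f zero = refl
cover-split (suc e) f zero = refl
cover-split e f (suc q) = begin
  suc (suc f) * cover e (suc f) q + e * cover (pred e) (suc (suc f)) q
    ≡⟨ cong₂ (λ x y → suc (suc f) * x + y) (cover-split e f q) (inner e) ⟩
  suc (suc f) * (x + y) + e * (p + (x + y))
    ≡⟨ solve 5 (λ e f x y p → (con 2 :+ f) :* (x :+ y) :+ e :* (p :+ (x :+ y)) :=
          (con 1 :+ f) :* x :+ e :* p :+ ((con 1 :+ f) :* y :+ (con 1 :+ e) :* (x :+ y))) refl e f x y p ⟩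
  suc f * x + e * p + (suc f * y + suc e * (x + y))
    ≡⟨ cong (λ z → suc f * x + e * p + (suc f * y + suc e * z)) (cover-split e f q) ⟨
  suc f * x + e * p + (suc f * y + suc e * cover e (suc f) q)
    ∎
  where
  open ≡-Reasoning
  open +-*-Solver
  x = cover e f q
  y = cover (suc e) f q
  p = cover (pred e) (suc f) q
  -- For e = 0 the value of `pred e` is wrong, but the factor e removes it.
  inner : ∀ e → e * cover (pred e) (suc (suc f)) q ≡ e * (cover (pred e) (suc f) q + (cover e f q + cover (suc e) f q))
  inner zero    = refl
  inner (suc e) = cong (suc e *_) (trans (cover-split e (suc f) q) (cong (cover e (suc f) q +_) (cover-split (suc e) f q)))

-- At m + 1 this is m ! times the number of surjections from a (q + 1)-set onto an (m + 1)-set. With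
-- this weight `chains (suc q)` is itself one step of `iter`, so the row recursion simply gains a
-- step.
surj : ℕ → ℕ → ℕ
surj q zero    = 0
surj q (suc m) = suc m ! * cover m 0 q

chains-suc : ∀ q m → chains (suc q) m ≡ iter 1 (surj q) m
chains-suc q zero    = cong (_+ 0) (trans (+-identityʳ _) (+-identityʳ _))
chains-suc q (suc m) = begin
  suc m ! * (1 * cover (suc m) 0 q + suc m * cover m 1 q)
    ≡⟨ cong (λ z → suc m ! * (1 * cover (suc m) 0 q + suc m * z)) (cover-split m 0 q) ⟩
  suc m ! * (1 * cover (suc m) 0 q + suc m * (cover m 0 q + cover (suc m) 0 q))
    ≡⟨ solve 4 (λ n m x y → n :* (con 1 :* y :+ (con 1 :+ m) :* (x :+ y)) :=
         (con 1 :+ m) :* (n :* x) :+ (con 2 :+ m) :* n :* y) refl (suc m !) m (cover m 0 q) (cover (suc m) 0 q) ⟩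
  suc m * (suc m ! * cover m 0 q) + suc (suc m) ! * cover (suc m) 0 q
    ∎
  where
  open ≡-Reasoning
  open +-*-Solver

-- Stirling numbers of the second kind S(k + 1 , m + 1).
stirling : ℕ → ℕ → ℕ
stirling zero    zero    = 1
stirling zero    (suc m) = 0
stirling (suc k) zero    = stirling k zero
stirling (suc k) (suc m) = suc (suc m) * stirling k (suc m) + stirling k m

stirling-0 : ∀ {k m} → k < m → stirling k m ≡ 0
stirling-0 {zero}  {suc m} _ = refl
stirling-0 {suc k} {suc m} (s≤s k<m)
  rewrite stirling-0 {k} {suc m} (≤-trans k<m (n≤1+n m)) | stirling-0 k<m = cong (_+ 0) (*-zeroʳ m)

-- Adjoin a point to the fibre over 0: a map from a q-set hitting 1, ..., m becomes a partition of a
-- (q + 1)-set into m + 1 blocks, m of which are labelled.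
surj-stirling : ∀ q m → surj q (suc m) ≡ suc m ! * m ! * stirling q m
surj-stirling q m = trans (cong (suc m ! *_) (cover-stirling q m)) (sym (*-assoc (suc m !) (m !) _))
  where
  cover-stirling : ∀ q m → cover m 0 q ≡ m ! * stirling q m
  cover-stirling zero    zero    = refl
  cover-stirling zero    (suc m) = sym (*-zeroʳ (suc m !))
  cover-stirling (suc q) zero    = trans (+-identityʳ _) (trans (+-identityʳ _) (cover-stirling q zero))
  cover-stirling (suc q) (suc m) = begin
    1 * cover (suc m) 0 q + suc m * cover m 1 q
      ≡⟨ cong (λ z → 1 * cover (suc m) 0 q + suc m * z) (cover-split m 0 q) ⟩
    1 * cover (suc m) 0 q + suc m * (cover m 0 q + cover (suc m) 0 q)
      ≡⟨ cong₂ (λ x y → 1 * y + suc m * (x + y)) (cover-stirling q m) (cover-stirling q (suc m)) ⟩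
    1 * (suc m ! * t) + suc m * (m ! * s + suc m ! * t)
      ≡⟨ solve 4 (λ n m s t → con 1 :* ((con 1 :+ m) :* n :* t) :+ (con 1 :+ m) :* (n :* s :+ (con 1 :+ m) :* n :* t) :=
           (con 1 :+ m) :* n :* ((con 2 :+ m) :* t :+ s)) refl (m !) m s t ⟩
    suc m ! * (suc (suc m) * t + s)
      ∎
    where
    open ≡-Reasoning
    open +-*-Solver
    s = stirling q m
    t = stirling q (suc m)

sumBelow : ℕ → (ℕ → ℕ) → ℕ
sumBelow zero    f = 0
sumBelow (suc m) f = f m + sumBelow m f

sumBelow-cong : ∀ {f g : ℕ → ℕ} m → (∀ i → f i ≡ g i) → sumBelow m f ≡ sumBelow m g
sumBelow-cong zero    f≗g = refl
sumBelow-cong (suc m) f≗g = cong₂ _+_ (f≗g m) (sumBelow-cong m f≗g)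

-- Summation by parts: the Stirling recursion is traded for one step of `iter` on the weight, and
-- the extra summand on the left is the boundary term.
sum-stirling-suc : ∀ k w m → sumBelow (suc m) (λ i → stirling (suc k) i * w (suc i)) + stirling k m * w (suc (suc m)) ≡
  sumBelow (suc m) (λ i → stirling k i * iter 1 w (suc i))
sum-stirling-suc k w zero =
  solve 3 (λ s x y → s :* x :+ con 0 :+ s :* y := s :* (con 1 :* x :+ y) :+ con 0) refl (stirling k 0) (w 1) (w 2)
  where open +-*-Solver
sum-stirling-suc k w (suc m) = begin
  (suc (suc m) * t + s) * x + r + t * y
    ≡⟨ solve 6 (λ m t s x r y → ((con 2 :+ m) :* t :+ s) :* x :+ r :+ t :* y :=
         t :* ((con 2 :+ m) :* x :+ y) :+ (r :+ s :* x)) refl m t s x r y ⟩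
  t * (suc (suc m) * x + y) + (r + s * x)
    ≡⟨ cong (t * (suc (suc m) * x + y) +_) (sum-stirling-suc k w m) ⟩
  t * (suc (suc m) * x + y) + sumBelow (suc m) (λ i → stirling k i * iter 1 w (suc i))
    ∎
  where
  open ≡-Reasoning
  open +-*-Solver
  s = stirling k m
  t = stirling k (suc m)
  x = w (suc (suc m))
  y = w (suc (suc (suc m)))
  r = sumBelow (suc m) (λ i → stirling (suc k) i * w (suc i))

-- Any cut-off m ≥ k will do, because the later Stirling numbers vanish. `iter-chains` takes k + q,
-- which gives both sides of the symmetry the same range.
iter-stirling : ∀ k w {m} → k ≤ m → iter k w 1 ≡ sumBelow (suc m) (λ i → stirling k i * w (suc i))
iter-stirling zero w {m} _ = delta m
  where
  delta : ∀ m → w 1 ≡ sumBelow (suc m) (λ i → stirling 0 i * w (suc i))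
  delta zero    = sym (trans (+-identityʳ _) (+-identityʳ _))
  delta (suc m) = delta m
iter-stirling (suc k) w {m} k<m = begin
  iter (suc k) w 1       ≡⟨ iter-step k w 1 ⟨
  iter k (iter 1 w) 1    ≡⟨ iter-stirling k (iter 1 w) (<⇒≤ k<m) ⟩
  sumBelow (suc m) (λ i → stirling k i * iter 1 w (suc i))
                         ≡⟨ sum-stirling-suc k w m ⟨
  sumBelow (suc m) (λ i → stirling (suc k) i * w (suc i)) + stirling k m * w (suc (suc m))
                         ≡⟨ cong (λ z → sumBelow (suc m) (λ i → stirling (suc k) i * w (suc i)) + z * w (suc (suc m))) (stirling-0 k<m) ⟩
  sumBelow (suc m) (λ i → stirling (suc k) i * w (suc i)) + 0
                         ≡⟨ +-identityʳ _ ⟩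
  sumBelow (suc m) (λ i → stirling (suc k) i * w (suc i)) ∎
  where open ≡-Reasoning

iter-chains : ∀ k q → iter k (chains (suc q)) 0 ≡
  sumBelow (suc (k + q)) (λ i → suc i ! * i ! * (stirling k i * stirling q i))
iter-chains k q = begin
  iter k (chains (suc q)) 0     ≡⟨ iter-cong k 0 (chains-suc q) ⟩
  iter k (iter 1 (surj q)) 0    ≡⟨ iter-step k (surj q) 0 ⟩
  -- Starting from m = 0, the first step has nothing to repeat and can only raise the count to 1.
  iter k (surj q) 1             ≡⟨ iter-stirling k (surj q) (m≤m+n k q) ⟩
  sumBelow (suc (k + q)) (λ i → stirling k i * surj q (suc i))
    ≡⟨ sumBelow-cong (suc (k + q)) (λ i → trans (cong (stirling k i *_) (surj-stirling q i))
         (solve 3 (λ s c t → s :* (c :* t) := c :* (s :* t)) refl (stirling k i) (suc i ! * i !) (stirling q i))) ⟩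
  sumBelow (suc (k + q)) (λ i → suc i ! * i ! * (stirling k i * stirling q i)) ∎
  where
  open ≡-Reasoning
  open +-*-Solver

iter-chains-sym : ∀ k q → iter k (chains (suc q)) 0 ≡ iter q (chains (suc k)) 0
iter-chains-sym k q = begin
  iter k (chains (suc q)) 0 ≡⟨ iter-chains k q ⟩
  sumBelow (suc (k + q)) (λ i → suc i ! * i ! * (stirling k i * stirling q i))
    ≡⟨ cong (λ m → sumBelow (suc m) (λ i → suc i ! * i ! * (stirling k i * stirling q i))) (+-comm k q) ⟩
  sumBelow (suc (q + k)) (λ i → suc i ! * i ! * (stirling k i * stirling q i))
    ≡⟨ sumBelow-cong (suc (q + k)) (λ i → cong (suc i ! * i ! *_) (*-comm (stirling k i) (stirling q i))) ⟩
  sumBelow (suc (q + k)) (λ i → suc i ! * i ! * (stirling q i * stirling k i))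
    ≡⟨ iter-chains q k ⟨
  iter q (chains (suc k)) 0 ∎
  where open ≡-Reasoning

-- Chains of subsets

true≢false : ∀ {x : Bool} → x ≡ true → x ≡ false → {A : Set} → A
true≢false refl ()

Row : ℕ → Set
Row = Vec Bool

∅ : ∀ {q} → Row q
∅ = Vec.replicate _ false

infix 4 _⊆_ _⊈_ _⊂_

-- `⊈` is a witness and not a negation: the element it supplies yields the arcs of a cycle and the
-- strictness of a chain step.
_⊆_ _⊈_ _⊂_ : ∀ {q} → Row q → Row q → Set
x ⊆ y = ∀ j → lookup x j ≡ true → lookup y j ≡ true
x ⊈ y = ∃ λ j → lookup x j ≡ true × lookup y j ≡ false
x ⊂ y = x ⊆ y × y ⊈ x

Comparable : ∀ {q} → Row q → Row q → Set
Comparable x y = x ⊆ y ⊎ y ⊆ x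

Nonempty : ∀ {q} → Row q → Set
Nonempty x = ∃ λ j → lookup x j ≡ true

module _ {q : ℕ} where

  ⊈⇒¬⊆ : ∀ {x y : Row q} → x ⊈ y → ¬ x ⊆ y
  ⊈⇒¬⊆ (j , xj , yj) x⊆y = true≢false (x⊆y j xj) yj

  ⊂-trans : ∀ {x y z : Row q} → x ⊂ y → y ⊂ z → x ⊂ z
  ⊂-trans (x⊆y , j , yj , xj) (y⊆z , _) = (λ i xi → y⊆z i (x⊆y i xi)) , j , y⊆z j yj , xj

  ⊂-irrefl : ∀ {x : Row q} → ¬ x ⊂ x
  ⊂-irrefl {x} (x⊆x , x⊈x) = ⊈⇒¬⊆ {x} {x} x⊈x x⊆x

  ∅⊆ : ∀ {x : Row q} → ∅ ⊆ x
  ∅⊆ j ∅j = true≢false ∅j (Vecₚ.lookup-replicate j false)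

  nonempty⇒∅⊂ : ∀ {x : Row q} → Nonempty x → ∅ ⊂ x
  nonempty⇒∅⊂ {x} (j , xj) = ∅⊆ {x} , j , xj , Vecₚ.lookup-replicate j false

  ∅⊂⇒nonempty : ∀ {x : Row q} → ∅ ⊂ x → Nonempty x
  ∅⊂⇒nonempty (_ , j , xj , _) = j , xj

⊆-or-⊈ : ∀ {q} (x y : Row q) → x ⊆ y ⊎ x ⊈ y
⊆-or-⊈ [] [] = inj₁ λ ()
⊆-or-⊈ (a ∷ x) (b ∷ y) with ⊆-or-⊈ x y
⊆-or-⊈ (a ∷ x) (b ∷ y)         | inj₂ (j , xj , yj) = inj₂ (suc j , xj , yj)
⊆-or-⊈ (false ∷ x) (b ∷ y)     | inj₁ x⊆y = inj₁ λ { zero () ; (suc j) → x⊆y j }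
⊆-or-⊈ (true ∷ x) (true ∷ y)   | inj₁ x⊆y = inj₁ λ { zero _ → refl ; (suc j) → x⊆y j }
⊆-or-⊈ (true ∷ x) (false ∷ y)  | inj₁ x⊆y = inj₂ (zero , refl , refl)

⊆-antisym : ∀ {q} (x y : Row q) → x ⊆ y → y ⊆ x → x ≡ y
⊆-antisym [] [] _ _ = refl
⊆-antisym (a ∷ x) (b ∷ y) x⊆y y⊆x = cong₂ _∷_ (bit a b (x⊆y zero) (y⊆x zero)) (⊆-antisym x y (x⊆y ∘ suc) (y⊆x ∘ suc))
  where
  bit : ∀ a b → (a ≡ true → b ≡ true) → (b ≡ true → a ≡ true) → a ≡ b
  bit false false _ _ = refl
  bit false true  _ g = g refl
  bit true  b     f _ = sym (f refl)

⊆∧≢⇒⊂ : ∀ {q} {x y : Row q} → x ⊆ y → x ≢ y → x ⊂ y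
⊆∧≢⇒⊂ {x = x} {y} x⊆y x≢y with ⊆-or-⊈ y x
... | inj₁ y⊆x = contradiction (⊆-antisym x y x⊆y y⊆x) x≢y
... | inj₂ y⊈x = x⊆y , y⊈x

-- Chains x₁ ⊆ x₂ ⊆ … above p in which the flagged steps are strict.
Step : ∀ {q} → Bool → Row q → Row q → Set
Step f p x = p ⊆ x × (f ≡ true → x ⊈ p)

data Flagged {q : ℕ} (p : Row q) : List Bool → List (Row q) → Set where
  []  : Flagged p [] []
  _∷_ : ∀ {f fs x xs} → Step f p x → Flagged x fs xs → Flagged p (f ∷ fs) (x ∷ xs)

flagged-length : ∀ {q} {p : Row q} {fs xs} → Flagged p fs xs → length xs ≡ length fs
flagged-length []       = refl
flagged-length (_ ∷ fl) = cong suc (flagged-length fl)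

trues falses : List Bool → ℕ
trues []           = 0
trues (true ∷ fs)  = suc (trues fs)
trues (false ∷ fs) = trues fs
falses []           = 0
falses (true ∷ fs)  = falses fs
falses (false ∷ fs) = suc (falses fs)

shiftColumn : Bool → List Bool × List Bool → List Bool × List Bool
shiftColumn f (bs , gs) = false ∷ bs , f ∷ gs

-- The possible columns of a chain, each with the flags it leaves to the other columns.
columns : List Bool → List (List Bool × List Bool)
columns []       = ([] , []) ∷ []
columns (f ∷ fs) = (true ∷ replicate (length fs) true , false ∷ fs) ∷
  map (shiftColumn f) (columns fs)

attach : ∀ {q} → List Bool → List (Row q) → List (Row (suc q))
attach = zipWith _∷_

flaggedChains : ∀ q → List Bool → List (List (Row q))
flaggedChains zero    []           = [] ∷ []
flaggedChains zero    (true ∷ fs)  = []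
flaggedChains zero    (false ∷ fs) = map ([] ∷_) (flaggedChains zero fs)
flaggedChains (suc q) fs           = concatMap (λ c → map (attach (proj₁ c)) (flaggedChains q (proj₂ c))) (columns fs)

weigh : (ℕ → ℕ → ℕ) → List Bool × List Bool → ℕ
weigh h (bs , gs) = h (trues gs) (falses gs)

-- An element that never enters the chain, or enters at an unflagged step, leaves the flags alone:
-- one choice more than there are unflagged steps. Entering at a flagged step makes that step strict
-- and clears its flag. This is the recursion of `cover`.
columns-sum : ∀ (h : ℕ → ℕ → ℕ) fs → sum (map (weigh h) (columns fs)) ≡
  suc (falses fs) * h (trues fs) (falses fs) + trues fs * h (pred (trues fs)) (suc (falses fs))
columns-sum h []           = sym (+-identityʳ (h 0 0 + 0))
columns-sum h (true ∷ fs)  = begin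
  h t (suc f) + sum (map (weigh h) (map (shiftColumn true) (columns fs)))
    ≡⟨ cong (λ l → h t (suc f) + sum l) (map-∘ (columns fs)) ⟨
  h t (suc f) + sum (map (weigh h ∘ shiftColumn true) (columns fs))
    ≡⟨ cong (h t (suc f) +_) (columns-sum (λ e → h (suc e)) fs) ⟩
  h t (suc f) + (suc f * h (suc t) f + t * h (suc (pred t)) (suc f))
    ≡⟨ cong (λ z → h t (suc f) + (suc f * h (suc t) f + z)) (restore t) ⟩
  h t (suc f) + (suc f * h (suc t) f + t * h t (suc f))
    ≡⟨ solve 3 (λ x y z → x :+ (y :+ z) := y :+ (x :+ z)) refl (h t (suc f)) (suc f * h (suc t) f) (t * h t (suc f)) ⟩
  suc f * h (suc t) f + suc t * h t (suc f)
    ∎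
  where
  open ≡-Reasoning
  open +-*-Solver
  t = trues fs
  f = falses fs
  restore : ∀ t → t * h (suc (pred t)) (suc f) ≡ t * h t (suc f)
  restore zero    = refl
  restore (suc t) = refl
columns-sum h (false ∷ fs) = begin
  h t (suc f) + sum (map (weigh h) (map (shiftColumn false) (columns fs)))
    ≡⟨ cong (λ l → h t (suc f) + sum l) (map-∘ (columns fs)) ⟨
  h t (suc f) + sum (map (weigh h ∘ shiftColumn false) (columns fs))
    ≡⟨ cong (h t (suc f) +_) (columns-sum (λ e g → h e (suc g)) fs) ⟩
  h t (suc f) + (suc f * h t (suc f) + t * h (pred t) (suc (suc f)))
    ≡⟨ +-assoc (h t (suc f)) (suc f * h t (suc f)) _ ⟨
  suc (suc f) * h t (suc f) + t * h (pred t) (suc (suc f))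
    ∎
  where
  open ≡-Reasoning
  t = trues fs
  f = falses fs

length-flaggedChains : ∀ q fs → length (flaggedChains q fs) ≡ cover (trues fs) (falses fs) q
length-flaggedChains zero    []           = refl
length-flaggedChains zero    (true ∷ fs)  = refl
length-flaggedChains zero    (false ∷ fs) = trans (length-map ([] ∷_) (flaggedChains zero fs))
  (trans (length-flaggedChains zero fs) (unflagged (trues fs)))
  where
  unflagged : ∀ e → cover e (falses fs) 0 ≡ cover e (suc (falses fs)) 0
  unflagged zero    = refl
  unflagged (suc e) = refl
length-flaggedChains (suc q) fs = trans (length-concatMap _ (columns fs))
  (trans (cong sum (map-cong (λ c → trans (length-map (attach (proj₁ c)) (flaggedChains q (proj₂ c))) (length-flaggedChains q (proj₂ c))) (columns fs)))
    (columns-sum (λ e f → cover e f q) fs))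

step-∷⁺ : ∀ {q f b} {p x : Row q} → Step f p x → Step f (b ∷ p) (b ∷ x)
step-∷⁺ (p⊆x , strict) = (λ { zero e → e ; (suc j) → p⊆x j }) , λ e → let j , xj , pj = strict e in suc j , xj , pj

step-∷⁻ : ∀ {q f b} {p x : Row q} → Step f (b ∷ p) (b ∷ x) → Step f p x
step-∷⁻ {b = b} (p⊆x , strict) = p⊆x ∘ suc , λ e → unsuc (strict e)
  where
  unsuc : ∀ {q} {p x : Row q} → (b ∷ x) ⊈ (b ∷ p) → x ⊈ p
  unsuc (zero , bt , bf)   = true≢false bt bf
  unsuc (suc j , xj , pj) = j , xj , pj

attach-trues⁺ : ∀ {q fs} {p : Row q} {xs} → Flagged p fs xs → Flagged (true ∷ p) fs (attach (replicate (length fs) true) xs)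
attach-trues⁺ []       = []
attach-trues⁺ (s ∷ fl) = step-∷⁺ s ∷ attach-trues⁺ fl

attach-trues⁻ : ∀ {q fs} {p : Row q} {ys} → Flagged (true ∷ p) fs ys →
  ∃ λ xs → ys ≡ attach (replicate (length fs) true) xs × Flagged p fs xs
attach-trues⁻ [] = [] , refl , []
attach-trues⁻ {ys = (false ∷ x) ∷ ys} ((p⊆ , _) ∷ fl) = contradiction (p⊆ zero refl) λ ()
attach-trues⁻ {ys = (true ∷ x) ∷ ys} (s ∷ fl) with attach-trues⁻ fl
... | xs , refl , fl' = x ∷ xs , refl , step-∷⁻ s ∷ fl'

attach⁺ : ∀ {q} fs {bs gs} {p : Row q} {xs} → (bs , gs) ∈ columns fs → Flagged p gs xs → Flagged (false ∷ p) fs (attach bs xs)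
attach⁺ []       (here refl) [] = []
attach⁺ (f ∷ fs) (here refl) ((p⊆x , _) ∷ fl) =
  -- The new element enters at this very step and so witnesses its strictness, whatever the flag.
  ((λ { zero () ; (suc j) → p⊆x j }) , λ _ → zero , refl , refl) ∷ attach-trues⁺ fl
attach⁺ (f ∷ fs) (there c∈) fl with ∈-map⁻ (shiftColumn f) c∈
attach⁺ (f ∷ fs) (there c∈) (s ∷ fl) | _ , c∈' , refl = step-∷⁺ s ∷ attach⁺ fs c∈' fl

attach⁻ : ∀ {q} fs {p : Row q} {ys} → Flagged (false ∷ p) fs ys →
  ∃ λ bs → ∃ λ gs → ∃ λ xs → (bs , gs) ∈ columns fs × ys ≡ attach bs xs × Flagged p gs xs
attach⁻ [] [] = [] , [] , [] , here refl , refl , []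
attach⁻ (f ∷ fs) {ys = (true ∷ x) ∷ ys} ((p⊆ , _) ∷ fl) with attach-trues⁻ fl
... | xs , refl , fl' = _ , _ , x ∷ xs , here refl , refl , (p⊆ ∘ suc , λ ()) ∷ fl'
attach⁻ (f ∷ fs) {ys = (false ∷ x) ∷ ys} (s ∷ fl) with attach⁻ fs fl
... | bs , gs , xs , c∈ , refl , fl' = _ , _ , x ∷ xs , there (∈-map⁺ (shiftColumn f) c∈) , refl , step-∷⁻ s ∷ fl'

∈-flaggedChains-zero⁻ : ∀ fs {xs} → xs ∈ flaggedChains zero fs → Flagged ∅ fs xs
∈-flaggedChains-zero⁻ []           (here refl) = []
∈-flaggedChains-zero⁻ (false ∷ fs) xs∈ with ∈-map⁻ ([] ∷_) xs∈
... | _ , xs∈' , refl = ((λ ()) , λ ()) ∷ ∈-flaggedChains-zero⁻ fs xs∈'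

∈-flaggedChains⁻ : ∀ q fs {xs} → xs ∈ flaggedChains q fs → Flagged ∅ fs xs
∈-flaggedChains⁻ zero    fs xs∈ = ∈-flaggedChains-zero⁻ fs xs∈
∈-flaggedChains⁻ (suc q) fs xs∈ with find (∈-concatMap⁻ _ {xs = columns fs} xs∈)
... | (bs , gs) , c∈ , xs∈' with ∈-map⁻ (attach bs) xs∈'
... | _ , xs∈'' , refl = attach⁺ fs c∈ (∈-flaggedChains⁻ q gs xs∈'')

∈-flaggedChains⁺ : ∀ q fs {xs} → Flagged ∅ fs xs → xs ∈ flaggedChains q fs
∈-flaggedChains⁺ zero    []           []             = here refl
∈-flaggedChains⁺ zero    (true ∷ fs)  ((_ , strict) ∷ _) with strict refl
... | () , _
∈-flaggedChains⁺ zero    (false ∷ fs) {[] ∷ xs} (_ ∷ fl) = ∈-map⁺ ([] ∷_) (∈-flaggedChains⁺ zero fs fl)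
∈-flaggedChains⁺ (suc q) fs fl with attach⁻ fs fl
... | bs , gs , xs , c∈ , refl , fl' = ∈-concatMap⁺ _ (lose c∈ (∈-map⁺ (attach bs) (∈-flaggedChains⁺ q gs fl')))

columns-unique : ∀ fs → Unique (map proj₁ (columns fs))
columns-unique []       = [] ∷ []
columns-unique (f ∷ fs) = All.tabulate fresh ∷ subst Unique
  (trans (sym (map-∘ (columns fs))) (map-∘ (columns fs)))
  (Uniqueₚ.map⁺ {f = false ∷_} ∷-injectiveʳ (columns-unique fs))
  where
  fresh : ∀ {bs} → bs ∈ map proj₁ (map (shiftColumn f) (columns fs)) → true ∷ replicate (length fs) true ≢ bs
  fresh bs∈ eq with ∈-map⁻ proj₁ bs∈
  ... | _ , c∈ , refl with ∈-map⁻ (shiftColumn f) c∈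
  fresh bs∈ () | _ , c∈ , refl | _ , _ , refl

columns-length : ∀ fs {bs gs} → (bs , gs) ∈ columns fs → length bs ≡ length gs
columns-length []       (here refl) = refl
columns-length (f ∷ fs) (here refl) = cong suc (length-replicate (length fs))
columns-length (f ∷ fs) (there c∈) with ∈-map⁻ (shiftColumn f) c∈
... | _ , c∈' , refl = cong suc (columns-length fs c∈')

map-head-attach : ∀ {q} bs (xs : List (Row q)) → length bs ≡ length xs → map Vec.head (attach bs xs) ≡ bs
map-head-attach []       []       _ = refl
map-head-attach (b ∷ bs) (x ∷ xs) e = cong (b ∷_) (map-head-attach bs xs (suc-injective e))

map-tail-attach : ∀ {q} bs (xs : List (Row q)) → length bs ≡ length xs → map Vec.tail (attach bs xs) ≡ xs
map-tail-attach []       []       _ = refl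
map-tail-attach (b ∷ bs) (x ∷ xs) e = cong (x ∷_) (map-tail-attach bs xs (suc-injective e))

flaggedChains-unique : ∀ q fs → Unique (flaggedChains q fs)
flaggedChains-unique zero    []           = [] ∷ []
flaggedChains-unique zero    (true ∷ fs)  = []
flaggedChains-unique zero    (false ∷ fs) = Uniqueₚ.map⁺ ∷-injectiveʳ (flaggedChains-unique zero fs)
flaggedChains-unique (suc q) fs = concatMap-unique (Uniqueₚ.map⁻ (columns-unique fs))
  (λ c∈ → map-unique-local (map Vec.tail) (flaggedChains-unique q _) (λ xs∈ → map-tail-attach _ _ (lengths c∈ xs∈)))
  (λ c∈ c∈' z∈ z∈' → unique-map-injective (columns-unique fs) c∈ c∈' (trans (sym (heads c∈ z∈)) (heads c∈' z∈')))
  where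
  lengths : ∀ {bs gs xs} → (bs , gs) ∈ columns fs → xs ∈ flaggedChains q gs → length bs ≡ length xs
  lengths {gs = gs} c∈ xs∈ = trans (columns-length fs c∈) (sym (flagged-length (∈-flaggedChains⁻ q gs xs∈)))
  heads : ∀ {bs gs zs} → (bs , gs) ∈ columns fs → zs ∈ map (attach bs) (flaggedChains q gs) → map Vec.head zs ≡ bs
  heads {bs} c∈ zs∈ with ∈-map⁻ (attach bs) zs∈
  ... | xs , xs∈ , refl = map-head-attach bs xs (lengths c∈ xs∈)

increasing⇒flagged : ∀ {q} {p : Row q} {xs} → AllPairs _⊂_ (p ∷ xs) → Flagged p (replicate (length xs) true) xs
increasing⇒flagged {xs = []}    _ = []
increasing⇒flagged {xs = _ ∷ _} (((p⊆x , x⊈p) ∷ _) ∷ xs↑) = (p⊆x , λ _ → x⊈p) ∷ increasing⇒flagged xs↑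

flagged⇒increasing : ∀ {q} {p : Row q} m {xs} → Flagged p (replicate m true) xs → AllPairs _⊂_ (p ∷ xs)
flagged⇒increasing zero    [] = [] ∷ []
flagged⇒increasing {p = p} (suc m) {x ∷ xs} ((p⊆x , strict) ∷ fl) with flagged⇒increasing m fl
... | x⊂ ∷ xs↑ = (p⊂x ∷ All.map (λ {y} → ⊂-trans {x = p} {x} {y} p⊂x) x⊂) ∷ (x⊂ ∷ xs↑)
  where p⊂x = p⊆x , strict refl

trues-replicate : ∀ m → trues (replicate m true) ≡ m
trues-replicate zero    = refl
trues-replicate (suc m) = cong suc (trues-replicate m)

falses-replicate : ∀ m → falses (replicate m true) ≡ 0
falses-replicate zero    = refl
falses-replicate (suc m) = falses-replicate m

-- Tuples of nonempty, pairwise comparable subsets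

module _ {q : ℕ} where

  NonemptyChain : List (Row q) → Set
  NonemptyChain xs = (∀ {x} → x ∈ xs → Nonempty x) × (∀ {x y} → x ∈ xs → y ∈ xs → Comparable x y)

  nonemptyChain-⊆ : ∀ {xs ys} → (∀ {x} → x ∈ ys → x ∈ xs) → NonemptyChain xs → NonemptyChain ys
  nonemptyChain-⊆ sub (ne , ch) = (λ x∈ → ne (sub x∈)) , (λ x∈ y∈ → ch (sub x∈) (sub y∈))

  increasing⇒comparable : ∀ {xs : List (Row q)} {x y} → AllPairs _⊂_ xs → x ∈ xs → y ∈ xs → Comparable x y
  increasing⇒comparable (_ ∷ _)  (here refl) (here refl) = inj₁ (λ j xj → xj)
  increasing⇒comparable (x⊂ ∷ _) (here refl) (there y∈)  = inj₁ (proj₁ (All.lookup x⊂ y∈))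
  increasing⇒comparable (y⊂ ∷ _) (there x∈)  (here refl) = inj₂ (proj₁ (All.lookup y⊂ x∈))
  increasing⇒comparable (_ ∷ ↑)  (there x∈)  (there y∈)  = increasing⇒comparable ↑ x∈ y∈

  increasing⇒unique : ∀ {xs : List (Row q)} → AllPairs _⊂_ xs → Unique xs
  increasing⇒unique = AllPairs.map λ { {x} x⊂y refl → ⊂-irrefl {x = x} x⊂y }

  -- If the heads differed, each would be strictly contained in the other. Hence an arrangement
  -- determines the chain it came from.
  increasing-↭⇒≡ : ∀ {xs ys : List (Row q)} → AllPairs _⊂_ xs → AllPairs _⊂_ ys → xs ↭ ys → xs ≡ ys
  increasing-↭⇒≡ {[]} _ _ p = sym (↭-empty-inv (↭-sym p))
  increasing-↭⇒≡ {x ∷ xs} {[]} _ _ p = ↭-empty-inv p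
  increasing-↭⇒≡ {x ∷ xs} {y ∷ ys} (x⊂ ∷ xs↑) (y⊂ ∷ ys↑) p with ∈-resp-↭ p (here refl) | ∈-resp-↭ (↭-sym p) (here refl)
  ... | here refl | _         = cong (x ∷_) (increasing-↭⇒≡ xs↑ ys↑ (drop-∷ p))
  ... | there _   | here refl = cong (x ∷_) (increasing-↭⇒≡ xs↑ ys↑ (drop-∷ p))
  ... | there x∈  | there y∈  = contradiction (⊂-trans {x = x} {y} {x} (All.lookup x⊂ y∈) (All.lookup y⊂ x∈)) (⊂-irrefl {x = x})

  insert : ∀ (x : Row q) ys → AllPairs _⊂_ ys → (∀ {y} → y ∈ ys → Comparable x y × x ≢ y) →
    ∃ λ zs → zs ↭ x ∷ ys × AllPairs _⊂_ zs
  insert x []       _          _   = x ∷ [] , ↭-refl , [] ∷ []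
  insert x (y ∷ ys) (y⊂ ∷ ys↑) cmp with cmp (here refl)
  ... | inj₁ x⊆y , x≢y = x ∷ y ∷ ys , ↭-refl , (x⊂y ∷ All.map (λ {z} → ⊂-trans {x = x} {y} {z} x⊂y) y⊂) ∷ (y⊂ ∷ ys↑)
    where x⊂y = ⊆∧≢⇒⊂ x⊆y x≢y
  ... | inj₂ y⊆x , x≢y with insert x ys ys↑ (λ y∈ → cmp (there y∈))
  ... | zs , p , zs↑ = y ∷ zs , ↭-trans (prep y p) (swap y x ↭-refl) ,
        All-resp-↭ (↭-sym p) (⊆∧≢⇒⊂ y⊆x (x≢y ∘ sym) ∷ y⊂) ∷ zs↑

  sort : ∀ (xs : List (Row q)) → Unique xs → (∀ {x y} → x ∈ xs → y ∈ xs → Comparable x y) →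
    ∃ λ zs → zs ↭ xs × AllPairs _⊂_ zs
  sort []       _          _  = [] , ↭-refl , []
  sort (x ∷ xs) (x∉ ∷ uxs) ch with sort xs uxs (λ x∈ y∈ → ch (there x∈) (there y∈))
  ... | ys , p , ys↑ with insert x ys ys↑ (λ y∈ → ch (here refl) (there (∈-resp-↭ p y∈)) , All.lookup x∉ (∈-resp-↭ p y∈))
  ... | zs , p' , zs↑ = zs , ↭-trans p' (prep x p) , zs↑

  anything : Row q → Bool
  anything _ = true

  arrangements : ℕ → List (List (Row q))
  arrangements m = concatMap (words (replicate m anything)) (flaggedChains q (replicate m true))

  fits-anything : ∀ xs → Fits (replicate (length xs) anything) xs
  fits-anything []       = []
  fits-anything (x ∷ xs) = refl ∷ fits-anything xs

  Arranged : ℕ → List (Row q) → Set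
  Arranged m xs = length xs ≡ m × Unique xs × NonemptyChain xs

  ∈-arrangements⁻ : ∀ m {xs} → xs ∈ arrangements m → Arranged m xs
  ∈-arrangements⁻ m xs∈ with find (∈-concatMap⁻ _ {xs = flaggedChains q (replicate m true)} xs∈)
  ... | ch , ch∈ , xs∈' with ∈-words⁻ (replicate m anything) xs∈' | ∈-flaggedChains⁻ q (replicate m true) ch∈
  ... | p , _ | fl with flagged⇒increasing m fl
  ... | ∅⊂ ∷ ch↑ = trans (↭-length p) (trans (flagged-length fl) (length-replicate m)) ,
        Unique-resp-↭ (↭-sym p) (increasing⇒unique ch↑) ,
        (λ {x} x∈ → ∅⊂⇒nonempty {x = x} (All.lookup ∅⊂ (∈-resp-↭ p x∈))) ,
        (λ x∈ y∈ → increasing⇒comparable ch↑ (∈-resp-↭ p x∈) (∈-resp-↭ p y∈))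

  ∈-arrangements⁺ : ∀ m {xs} → Arranged m xs → xs ∈ arrangements m
  ∈-arrangements⁺ _ {xs} (refl , uxs , ne , ch) with sort xs uxs ch
  ... | zs , p , zs↑ = ∈-concatMap⁺ _ (lose
        (∈-flaggedChains⁺ q (replicate (length xs) true) (subst (λ l → Flagged ∅ (replicate l true) zs) (↭-length p)
          (increasing⇒flagged (All.tabulate (λ {z} z∈ → nonempty⇒∅⊂ {x = z} (ne (∈-resp-↭ p z∈))) ∷ zs↑))))
        (∈-words⁺ (↭-sym p) (fits-anything xs)))

  arrangements-unique : ∀ m → Unique (arrangements m)
  arrangements-unique m = concatMap-unique (flaggedChains-unique q (replicate m true))
    (λ ch∈ → words-unique (replicate m anything) (increasing⇒unique (chain↑ ch∈)))
    (λ ch∈ ch∈' w∈ w∈' → increasing-↭⇒≡ (chain↑ ch∈) (chain↑ ch∈')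
      (↭-trans (↭-sym (proj₁ (∈-words⁻ (replicate m anything) w∈))) (proj₁ (∈-words⁻ (replicate m anything) w∈'))))
    where
    chain↑ : ∀ {ch} → ch ∈ flaggedChains q (replicate m true) → AllPairs _⊂_ ch
    chain↑ ch∈ with flagged⇒increasing m (∈-flaggedChains⁻ q (replicate m true) ch∈)
    ... | _ ∷ ch↑ = ch↑

  length-arrangements : ∀ m → length (arrangements m) ≡ chains q m
  length-arrangements m = begin
    length (arrangements m)
      ≡⟨ length-concatMap (words (replicate m anything)) (flaggedChains q (replicate m true)) ⟩
    sum (map (length ∘ words (replicate m anything)) (flaggedChains q (replicate m true)))
      ≡⟨ sum-map-const (flaggedChains q (replicate m true)) orders ⟩
    length (flaggedChains q (replicate m true)) * m !
      ≡⟨ cong (_* m !) (trans (length-flaggedChains q (replicate m true))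
           (cong₂ (λ e f → cover e f q) (trues-replicate m) (falses-replicate m))) ⟩
    cover m 0 q * m !
      ≡⟨ *-comm (cover m 0 q) (m !) ⟩
    chains q m
      ∎
    where
    open ≡-Reasoning
    orders : ∀ {ch} → ch ∈ flaggedChains q (replicate m true) → length (words (replicate m anything) ch) ≡ m !
    orders {ch} ch∈ = trans (length-words (replicate m anything) ch)
      (per-allowed m (trans (flagged-length (∈-flaggedChains⁻ q (replicate m true) ch∈)) (length-replicate m))
        (All.tabulate (λ _ → refl)))

  -- Tuples r of nonempty pairwise comparable rows, preceded by m distinct rows d that they may repeat.
  Tuple : ℕ → Set
  Tuple k = List (Row q) × Vec (Row q) k

  ValidTuple : ∀ {k} → ℕ → Tuple k → Set
  ValidTuple m (ds , rs) = length ds ≡ m × Unique ds × NonemptyChain (ds ++ toList rs)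

  repeats : ∀ {k} → Tuple k → List (Tuple (suc k))
  repeats (ds , rs) = map (λ r → ds , r ∷ rs) ds

  -- The `[]` clause is a dummy: `demote` is applied to tuples with `suc m` distinct rows.
  demote : ∀ {k} → Tuple k → Tuple (suc k)
  demote (r ∷ ds , rs) = ds , r ∷ rs
  demote ([]     , rs) = [] , ∅ ∷ rs

  promote : ∀ {k} → Tuple (suc k) → Tuple k
  promote (ds , r ∷ rs) = r ∷ ds , rs

  tuples : ∀ k → ℕ → List (Tuple k)
  tuples zero    m = map (_, []) (arrangements m)
  tuples (suc k) m = concatMap repeats (tuples k m) ++ map demote (tuples k (suc m))

  ∈-demoted : ∀ {r x : Row q} ds {rs} → x ∈ ds ++ r ∷ rs → x ∈ r ∷ ds ++ rs
  ∈-demoted []       x∈         = x∈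
  ∈-demoted (d ∷ ds) (here eq)  = there (here eq)
  ∈-demoted (d ∷ ds) (there x∈) with ∈-demoted ds x∈
  ... | here eq   = here eq
  ... | there x∈' = there (there x∈')

  ∈-tuples⁻ : ∀ k m {t} → t ∈ tuples k m → ValidTuple m t
  ∈-tuples⁻ zero m t∈ with ∈-map⁻ (_, []) t∈
  ... | ds , ds∈ , refl with ∈-arrangements⁻ m ds∈
  ... | len , uds , nc = len , uds , subst NonemptyChain (sym (++-identityʳ ds)) nc
  ∈-tuples⁻ (suc k) m t∈ with ∈-++⁻ (concatMap repeats (tuples k m)) t∈
  ... | inj₁ t∈' = repeated (find (∈-concatMap⁻ repeats {xs = tuples k m} t∈'))
    where
    repeated : ∀ {t} → (∃ λ s → s ∈ tuples k m × t ∈ repeats s) → ValidTuple m t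
    repeated ((ds , rs) , s∈ , t∈) with ∈-map⁻ _ t∈ | ∈-tuples⁻ k m s∈
    ... | r , r∈ , refl | len , uds , nc = len , uds , nonemptyChain-⊆ sub nc
      where
      sub : ∀ {x} → x ∈ ds ++ r ∷ toList rs → x ∈ ds ++ toList rs
      sub x∈ with ∈-demoted ds x∈
      ... | here refl = ∈-++⁺ˡ r∈
      ... | there x∈' = x∈'
  ... | inj₂ t∈' = demoted (∈-map⁻ demote t∈')
    where
    demoted : ∀ {t} → (∃ λ s → s ∈ tuples k (suc m) × t ≡ demote s) → ValidTuple m t
    demoted ((ds , rs) , s∈ , eq) with ∈-tuples⁻ k (suc m) s∈
    demoted ((r ∷ ds , rs) , s∈ , refl) | len , _ ∷ uds , nc = suc-injective len , uds , nonemptyChain-⊆ (∈-demoted ds) nc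

  ∈-tuples⁺ : ∀ k m {t} → ValidTuple m t → t ∈ tuples k m
  ∈-tuples⁺ zero m {ds , []} (len , uds , nc) =
    ∈-map⁺ (_, []) (∈-arrangements⁺ m (len , uds , subst NonemptyChain (++-identityʳ ds) nc))
  ∈-tuples⁺ (suc k) m {ds , r ∷ rs} (len , uds , nc) with DecMembership._∈?_ (Vecₚ.≡-dec Boolₚ._≟_) r ds
  ... | yes r∈ = ∈-++⁺ˡ (∈-concatMap⁺ repeats (lose
        (∈-tuples⁺ k m {ds , rs} (len , uds , nonemptyChain-⊆ (later ds) nc)) (∈-map⁺ _ r∈)))
    where
    later : ∀ ds {x} → x ∈ ds ++ toList rs → x ∈ ds ++ r ∷ toList rs
    later []       x∈         = there x∈
    later (d ∷ ds) (here eq)  = here eq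
    later (d ∷ ds) (there x∈) = there (later ds x∈)
  ... | no r∉ = ∈-++⁺ʳ (concatMap repeats (tuples k m)) (∈-map⁺ demote
        (∈-tuples⁺ k (suc m) {r ∷ ds , rs} (cong suc len , All.tabulate (λ { x∈ refl → r∉ x∈ }) ∷ uds , nonemptyChain-⊆ (front ds) nc)))
    where
    front : ∀ ds {x} → x ∈ r ∷ ds ++ toList rs → x ∈ ds ++ r ∷ toList rs
    front []       x∈                 = x∈
    front (d ∷ ds) (here eq)          = there (front ds (here eq))
    front (d ∷ ds) (there (here eq))  = here eq
    front (d ∷ ds) (there (there x∈)) = there (front ds (there x∈))

  tuples-unique : ∀ k m → Unique (tuples k m)
  tuples-unique zero    m = Uniqueₚ.map⁺ (cong proj₁) (arrangements-unique m)
  tuples-unique (suc k) m = Uniqueₚ.++⁺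
    (concatMap-unique (tuples-unique k m)
      (λ s∈ → Uniqueₚ.map⁺ (λ { refl → refl }) (proj₁ (proj₂ (∈-tuples⁻ k m s∈))))
      (λ _ _ z∈ z∈' → trans (sym (forget z∈)) (forget z∈')))
    (map-unique-local promote (tuples-unique k (suc m)) promote-demote)
    disjoint
    where
    rest : Tuple (suc k) → Tuple k
    rest (ds , _ ∷ rs) = ds , rs
    forget : ∀ {s z} → z ∈ repeats s → rest z ≡ s
    forget z∈ with ∈-map⁻ _ z∈
    ... | _ , _ , refl = refl
    promote-demote : ∀ {s} → s ∈ tuples k (suc m) → promote (demote s) ≡ s
    promote-demote {_ ∷ _ , _} _ = refl
    promote-demote {[] , _} s∈ with ∈-tuples⁻ k (suc m) s∈
    ... | () , _
    disjoint : ∀ {t} → ¬ (t ∈ concatMap repeats (tuples k m) × t ∈ map demote (tuples k (suc m)))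
    disjoint (t∈ , t∈') = clash (find (∈-concatMap⁻ repeats {xs = tuples k m} t∈)) (∈-map⁻ demote t∈')
      where
      clash : ∀ {t} → (∃ λ s → s ∈ tuples k m × t ∈ repeats s) → ¬ (∃ λ s → s ∈ tuples k (suc m) × t ≡ demote s)
      clash (_ , _ , t∈s) ((ds , rs) , s∈ , eq) with ∈-map⁻ _ t∈s | ∈-tuples⁻ k (suc m) s∈
      clash (_ , _ , t∈s) ((r ∷ ds , rs) , s∈ , refl) | _ , r∈ , refl | _ , r∉ ∷ _ , _ = All.lookup r∉ r∈ refl

  length-tuples : ∀ k m → length (tuples k m) ≡ iter k (chains q) m
  length-tuples zero    m = trans (length-map (_, []) (arrangements m)) (length-arrangements m)
  length-tuples (suc k) m = begin
    length (concatMap repeats (tuples k m) ++ map demote (tuples k (suc m)))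
      ≡⟨ length-++ (concatMap repeats (tuples k m)) ⟩
    length (concatMap repeats (tuples k m)) + length (map demote (tuples k (suc m)))
      ≡⟨ cong₂ _+_ (trans (length-concatMap repeats (tuples k m)) (sum-map-const (tuples k m) choices))
           (trans (length-map demote (tuples k (suc m))) (length-tuples k (suc m))) ⟩
    length (tuples k m) * m + iter k (chains q) (suc m)
      ≡⟨ cong (_+ iter k (chains q) (suc m)) (trans (cong (_* m) (length-tuples k m)) (*-comm (iter k (chains q) m) m)) ⟩
    m * iter k (chains q) m + iter k (chains q) (suc m)
      ∎
    where
    open ≡-Reasoning
    choices : ∀ {s} → s ∈ tuples k m → length (repeats s) ≡ m
    choices {ds , rs} s∈ = trans (length-map _ ds) (proj₁ (∈-tuples⁻ k m s∈))

  count-rows : ∀ k → CountIs (λ (rs : Vec (Row q) k) → NonemptyChain (toList rs)) (iter k (chains q) 0)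
  count-rows k = map proj₂ (tuples k 0) , trans (length-map proj₂ (tuples k 0)) (length-tuples k 0) ,
    map-unique-local ([] ,_) (tuples-unique k 0) no-distinct , λ rs → sound , λ nc → ∈-map⁺ proj₂ (∈-tuples⁺ k 0 {[] , rs} (refl , [] , nc))
    where
    no-distinct : ∀ {s} → s ∈ tuples k 0 → ([] , proj₂ s) ≡ s
    no-distinct {[] , _} _ = refl
    no-distinct {_ ∷ _ , _} s∈ with ∈-tuples⁻ k 0 s∈
    ... | () , _
    sound : ∀ {rs} → rs ∈ map proj₂ (tuples k 0) → NonemptyChain (toList rs)
    sound rs∈ with ∈-map⁻ proj₂ rs∈
    ... | ([] , _) , s∈ , refl = proj₂ (proj₂ (∈-tuples⁻ k 0 s∈))
    ... | (_ ∷ _ , _) , s∈ , refl with ∈-tuples⁻ k 0 s∈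
    ...   | () , _

-- Orientations with a unique sink

module _ {p q : ℕ} (o : Orientation p q) where

  -- Arc x y implies this relation, which is closed under composing with arcs and never relates x to itself.
  Above : Vertex p q → Vertex p q → Set
  Above (inj₁ i) (inj₁ k) = lookup o i ⊈ lookup o k
  Above (inj₁ i) (inj₂ j) = lookup (lookup o i) j ≡ true
  Above (inj₂ j) (inj₁ i) = lookup (lookup o i) j ≡ false
  Above (inj₂ j) (inj₂ l) = ∃ λ i → lookup (lookup o i) j ≡ false × lookup (lookup o i) l ≡ true

  arc⇒above : ∀ {x y} → Arc o x y → Above x y
  arc⇒above (lr i j e) = e
  arc⇒above (rl i j e) = e

  above-irrefl : ∀ x → ¬ Above x x
  above-irrefl (inj₁ i) (j , t , f) = true≢false t f
  above-irrefl (inj₂ j) (i , f , t) = true≢false t f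

  module _ (comparable : ∀ i k → Comparable (lookup o i) (lookup o k)) where

    ⊈⇒⊇ : ∀ i k → lookup o i ⊈ lookup o k → lookup o k ⊆ lookup o i
    ⊈⇒⊇ i k i⊈k with comparable i k
    ... | inj₁ i⊆k = contradiction i⊆k (⊈⇒¬⊆ {x = lookup o i} {lookup o k} i⊈k)
    ... | inj₂ k⊆i = k⊆i

    ⊆-false : ∀ i k {j} → lookup o i ⊆ lookup o k → lookup (lookup o k) j ≡ false → lookup (lookup o i) j ≡ false
    ⊆-false i k {j} i⊆k kj = Boolₚ.¬-not λ ij → true≢false (i⊆k j ij) kj

    -- In the two middle cases comparability is essential: one element outside a neighbourhood is
    -- turned into an inclusion the other way round.
    arc-above : ∀ {x y} z → Arc o x y → Above y z → Above x z
    arc-above (inj₁ k) (lr i j ij) kj            = j , ij , kj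
    arc-above (inj₂ l) (lr i j ij) (k , kj , kl) = ⊈⇒⊇ i k (j , ij , kj) l kl
    arc-above (inj₁ k) (rl i j ij) i⊈k           = ⊆-false k i (⊈⇒⊇ i k i⊈k) ij
    arc-above (inj₂ l) (rl i j ij) il            = i , ij , il

    path⇒above : ∀ {x y} → TransClosure (Arc o) x y → Above x y
    path⇒above [ arc ]        = arc⇒above arc
    path⇒above (arc ∷ path) = arc-above _ arc (path⇒above path)

    comparable⇒acyclic : Acyclic o
    comparable⇒acyclic x cycle = above-irrefl x (path⇒above cycle)

  -- Two incomparable neighbourhoods span a directed 4-cycle.
  acyclic⇒comparable : Acyclic o → ∀ i k → Comparable (lookup o i) (lookup o k)
  acyclic⇒comparable acyclic i k with ⊆-or-⊈ (lookup o i) (lookup o k) | ⊆-or-⊈ (lookup o k) (lookup o i)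
  ... | inj₁ i⊆k | _        = inj₁ i⊆k
  ... | inj₂ _   | inj₁ k⊆i = inj₂ k⊆i
  ... | inj₂ (j , ij , kj) | inj₂ (l , kl , il) =
    contradiction (lr i j ij ∷ rl k j kj ∷ lr k l kl ∷ [ rl i l il ]) (acyclic (inj₁ i))

  left-sink⇒∅ : ∀ {i} → IsSink o (inj₁ i) → lookup o i ≡ ∅
  left-sink⇒∅ {i} sink = ⊆-antisym (lookup o i) ∅ (λ j ij → contradiction (lr i j ij) (sink (inj₂ j))) (∅⊆ {x = lookup o i})

  ∅⇒left-sink : ∀ {i} → lookup o i ≡ ∅ → IsSink o (inj₁ i)
  ∅⇒left-sink {i} eq _ (lr _ j ij) = true≢false ij (trans (cong (λ x → lookup x j) eq) (Vecₚ.lookup-replicate j false))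

  nonempty-or-∅ : ∀ (x : Row q) → Nonempty x ⊎ x ≡ ∅
  nonempty-or-∅ x with ⊆-or-⊈ x ∅
  ... | inj₁ x⊆∅         = inj₂ (⊆-antisym x ∅ x⊆∅ (∅⊆ {x = x}))
  ... | inj₂ (j , xj , _) = inj₁ (j , xj)

∈-toList⇒lookup : ∀ {A : Set} {n} (xs : Vec A n) {x} → x ∈ toList xs → ∃ λ j → lookup xs j ≡ x
∈-toList⇒lookup xs x∈ = VecAny.index x∈xs , sym (VecAnyₚ.lookup-index x∈xs)
  where x∈xs = ∈-toList⁻ {xs = xs} x∈

module _ {k q : ℕ} (i : Fin (suc k)) where

  insertAt-cases : ∀ {A : Set} (xs : Vec A k) (x : A) l →
    (l ≡ i) ⊎ lookup (insertAt xs i x) l ∈ toList xs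
  insertAt-cases xs x l with i Finₚ.≟ l
  ... | yes i≡l = inj₁ (sym i≡l)
  ... | no i≢l  = inj₂ (subst (_∈ toList xs)
          (trans (sym (Vecₚ.insertAt-punchIn xs i x (Fin.punchOut i≢l))) (cong (lookup (insertAt xs i x)) (Finₚ.punchIn-punchOut i≢l)))
          (∈-toList⁺ (∈-lookup (Fin.punchOut i≢l) xs)))

  -- The empty row makes every right vertex point to i, and the other left vertices have outgoing
  -- arcs because their rows are nonempty.
  rows⇒unique-sink : ∀ {rs : Vec (Row q) k} → NonemptyChain (toList rs) → AcyclicUniqueSinkAt (inj₁ i) (insertAt rs i ∅)
  rows⇒unique-sink {rs} (ne , ch) = comparable⇒acyclic o comparable , ∅⇒left-sink o row-i , unique
    where
    o = insertAt rs i ∅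
    row-i : lookup o i ≡ ∅
    row-i = Vecₚ.insertAt-lookup rs i ∅
    comparable : ∀ l m → Comparable (lookup o l) (lookup o m)
    comparable l m with insertAt-cases rs ∅ l | insertAt-cases rs ∅ m
    ... | inj₁ refl | _         = inj₁ (subst (_⊆ lookup o m) (sym row-i) (∅⊆ {x = lookup o m}))
    ... | inj₂ _    | inj₁ refl = inj₂ (subst (_⊆ lookup o l) (sym row-i) (∅⊆ {x = lookup o l}))
    ... | inj₂ l∈   | inj₂ m∈   = ch l∈ m∈
    unique : ∀ x → IsSink o x → x ≡ inj₁ i
    unique (inj₂ j) sink = contradiction (rl i j (trans (cong (λ x → lookup x j) row-i) (Vecₚ.lookup-replicate j false))) (sink (inj₁ i))
    unique (inj₁ l) sink with insertAt-cases rs ∅ l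
    ... | inj₁ refl = refl
    ... | inj₂ l∈ with ne l∈
    ... | j , lj = contradiction (lr l j lj) (sink (inj₂ j))

  module _ {o : Orientation (suc k) q} (auso : AcyclicUniqueSinkAt (inj₁ i) o) where

    lookup-removeAt : ∀ j → lookup (removeAt o i) j ≡ lookup o (Fin.punchIn i j)
    lookup-removeAt j = trans (sym (Vecₚ.insertAt-punchIn (removeAt o i) i (lookup o i) j))
      (cong (λ v → lookup v (Fin.punchIn i j)) (Vecₚ.insertAt-removeAt o i))

    unique-sink⇒rows : NonemptyChain (toList (removeAt o i))
    unique-sink⇒rows = nonempty , comparable
      where
      nonempty : ∀ {x} → x ∈ toList (removeAt o i) → Nonempty x
      nonempty x∈ with ∈-toList⇒lookup (removeAt o i) x∈
      ... | j , refl with nonempty-or-∅ o (lookup (removeAt o i) j)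
      ... | inj₁ ne = ne
      ... | inj₂ eq with proj₂ (proj₂ auso) (inj₁ (Fin.punchIn i j)) (∅⇒left-sink o (trans (sym (lookup-removeAt j)) eq))
      ... | e = contradiction (inj₁-injective e) (Finₚ.punchInᵢ≢i i j)
      comparable : ∀ {x y} → x ∈ toList (removeAt o i) → y ∈ toList (removeAt o i) → Comparable x y
      comparable x∈ y∈ with ∈-toList⇒lookup (removeAt o i) x∈ | ∈-toList⇒lookup (removeAt o i) y∈
      ... | j , refl | l , refl rewrite lookup-removeAt j | lookup-removeAt l = acyclic⇒comparable o (proj₁ auso) _ _

    insert-removed : insertAt (removeAt o i) i ∅ ≡ o
    insert-removed = trans (cong (insertAt (removeAt o i) i) (sym (left-sink⇒∅ o (proj₁ (proj₂ auso))))) (Vecₚ.insertAt-removeAt o i)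

  count-left-sink : CountIs (AcyclicUniqueSinkAt {suc k} {q} (inj₁ i)) (iter k (chains q) 0)
  count-left-sink = CountIs-bijection (λ rs → insertAt rs i ∅) (λ o → removeAt o i)
    rows⇒unique-sink unique-sink⇒rows (λ rs → Vecₚ.removeAt-insertAt rs i ∅) insert-removed (count-rows k)

module _ {p q : ℕ} where

  -- The entry true means left to right, so transposing also negates.
  exchange : Orientation p q → Orientation q p
  exchange o = tabulate λ j → tabulate λ i → not (lookup (lookup o i) j)

  lookup-exchange : ∀ o j i → lookup (lookup (exchange o) j) i ≡ not (lookup (lookup o i) j)
  lookup-exchange o j i = trans (cong (λ r → lookup r i) (Vecₚ.lookup∘tabulate _ j)) (Vecₚ.lookup∘tabulate _ i)

  exchange-arc⁺ : ∀ {o x y} → Arc o x y → Arc (exchange o) (Sum.swap x) (Sum.swap y)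
  exchange-arc⁺ {o} (lr i j e) = rl j i (trans (lookup-exchange o j i) (cong not e))
  exchange-arc⁺ {o} (rl i j e) = lr j i (trans (lookup-exchange o j i) (cong not e))

  exchange-arc⁻ : ∀ {o x y} → Arc (exchange o) x y → Arc o (Sum.swap x) (Sum.swap y)
  exchange-arc⁻ {o} (lr j i e) = rl i j (Boolₚ.not-injective (trans (sym (lookup-exchange o j i)) e))
  exchange-arc⁻ {o} (rl j i e) = lr i j (Boolₚ.not-injective (trans (sym (lookup-exchange o j i)) e))

  exchange-path⁻ : ∀ {o x y} → TransClosure (Arc (exchange o)) x y → TransClosure (Arc o) (Sum.swap x) (Sum.swap y)
  exchange-path⁻ [ arc ]      = [ exchange-arc⁻ arc ]
  exchange-path⁻ (arc ∷ path) = exchange-arc⁻ arc ∷ exchange-path⁻ path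

  exchange-sink : ∀ {v o} → AcyclicUniqueSinkAt v o → AcyclicUniqueSinkAt (Sum.swap v) (exchange o)
  exchange-sink {v} {o} (acyclic , sink , unique) = (λ x cycle → acyclic (Sum.swap x) (exchange-path⁻ cycle)) ,
    (λ y arc → sink (Sum.swap y) (subst (λ z → Arc o z (Sum.swap y)) (swap-involutive v) (exchange-arc⁻ arc))) ,
    λ x sink-x → trans (sym (swap-involutive x)) (cong Sum.swap (unique (Sum.swap x) λ y arc →
      sink-x (Sum.swap y) (subst (λ z → Arc (exchange o) z (Sum.swap y)) (swap-involutive x) (exchange-arc⁺ arc))))

exchange-involutive : ∀ {p q} (o : Orientation p q) → exchange (exchange o) ≡ o
exchange-involutive o = trans (Vecₚ.tabulate-cong λ i → trans (Vecₚ.tabulate-cong λ j →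
    trans (cong not (lookup-exchange o j i)) (Boolₚ.not-involutive _)) (Vecₚ.tabulate∘lookup (lookup o i)))
  (Vecₚ.tabulate∘lookup o)

count-right-sink : ∀ {k q} (j : Fin (suc k)) → CountIs (AcyclicUniqueSinkAt {q} {suc k} (inj₂ j)) (iter k (chains q) 0)
count-right-sink j = CountIs-bijection exchange exchange exchange-sink exchange-sink exchange-involutive
  (λ {o} _ → exchange-involutive o) (count-left-sink j)

-- For a sink on the right the exchanged orientation is counted with a and b interchanged, so the
-- symmetry of the count is needed.
count-sink : ∀ a b (v : Vertex (suc a) (suc b)) → CountIs (AcyclicUniqueSinkAt v) (iter a (chains (suc b)) 0)
count-sink a b (inj₁ i) = count-left-sink i
count-sink a b (inj₂ j) = subst (CountIs _) (iter-chains-sym b a) (count-right-sink j)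

theorem2p5 : (n : ℕ) → 2 ≤ n →
    (v : Vertex ⌈ n /2⌉ (suc ⌊ n /2⌋)) →
    Σ ℕ λ k → CountIs (Toppleable n) k × CountIs (AcyclicUniqueSinkAt v) k
theorem2p5 (suc n) _ v = iter a (chains (suc b)) 0 ,
  CountIs-⇔ (λ {π} (perm , band) → in-band⇒toppleable n≡ refl (subst (λ m → IsPerm m π) (sym n≡) perm , band))
    (λ {π} t → let perm , band = toppleable⇒in-band n≡ refl t in subst (λ m → IsPerm m π) n≡ perm , band)
    (BandCount.count-in-band a b) ,
  count-sink a b v
  where
  -- Here `n` is one less than in the statement, so `⌈ suc n /2⌉` computes to `suc a` and the two
  -- parts have sizes `suc a` and `suc b`.
  a = ⌊ n /2⌋
  b = ⌊ suc n /2⌋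
  n≡ : suc n ≡ suc (a + b)
  n≡ = cong suc (sym (⌊n/2⌋+⌈n/2⌉≡n n))
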